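{- Let $a,b\ge2$ be integers. Rowmotion on the fence $\breve F(a,b)$ has the following properties. (a) All orbits $\mathcal O$ have size $\ell=\operatorname{lcm}(a,b)$ except for one, $\mathcal O'$, which is the orbit of the empty set and has size $\ell+1$. (b) The number of orbits is $\gcd(a,b)$. (c) For any orbit $\mathcal O$ of size $\ell$, $$\chi(\mathcal O)=\frac{2ab-a-b}{\gcd(a,b)}=:m,$$ and for the orbit of size $\ell+1$, $\chi(\mathcal O')=m+1$. (d) For any orbit $\mathcal O$ of size $\ell$, $$\hat\chi(\mathcal O)=\frac{\ell(a+b-2)}{2},$$ and for the orbit of size $\ell+1$, $$\hat\chi(\mathcal O')=\frac{(\ell+2)(a+b-2)}{2}+1.$$
   Context: The fence $\breve F(a,b)$ is the poset on $x_1,\dots,x_{a+b-1}$ with covering relations $x_1\lhd x_2\lhd\cdots\lhd x_a\rhd x_{a+1}\rhd\cdots\rhd x_{a+b-1}$. For a finite poset $P$, rowmotion on antichains is the bijection $\rho$ on the set of antichains sending $A$ to the set of minimal elements of $P\setminus I$, where $I$ is the (lower order) ideal generated by $A$. Rowmotion on ideals is the bijection $\hat\rho$ on the set of ideals sending $I$ to the ideal generated by the minimal elements of $P\setminus I$. Orbits are those of the cyclic groups generated by these maps; $A\mapsto$ (ideal generated by $A$) gives a size-preserving bijection between orbits of $\rho$ and of $\hat\rho$, and corresponding orbits are denoted by the same letter. For an orbit $\mathcal O$, $\chi(\mathcal O)=\sum_{A}\#A$ over the antichains $A$ in the orbit, and $\hat\chi(\mathcal O)=\sum_I\#I$ over the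 ideals $I$ in the orbit. -}

module Defs where

open import Level using (0ℓ)
import Data.Bool.Properties as Bool
open import Data.Nat.Base as ℕ using (ℕ; zero; suc; _∸_; _<_; _≤_; s≤s; NonZero; ≢-nonZero)
import Data.Nat.Properties as ℕ
open import Data.Nat.GCD using (gcd; gcd[m,n]≢0)
open import Data.Integer.Base as ℤ using (ℤ; +_; -[1+_])
import Data.Integer.Properties as ℤ
open import Data.Rational.Base as ℚ using (ℚ)
open import Data.Fin.Base using (Fin; toℕ; fromℕ<)
open import Data.Fin.Properties using (any?; all?; toℕ<n; toℕ-injective; toℕ-fromℕ<)
open import Data.Fin.Induction using (po-wellFounded)
open import Data.Fin.Subset using (Subset; ∁; ⊥; _∈_)
open import Data.Fin.Subset.Properties
  using (_∈?_; ⊆-antisym; ∉⊥; x∈∁p⇒x∉p; x∉p⇒x∈∁p; x∈p⇒x∉∁p; x∉∁p⇒x∈p)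
open import Data.List.Base using (List; length; map)
import Data.List.Membership.Propositional as List
open import Data.Nat.ListAction using (sum)
open import Data.List.Relation.Unary.Unique.Propositional using (Unique)
open import Data.Vec.Base using (tabulate)
open import Data.Vec.Properties using (lookup∘tabulate; []=⇒lookup; lookup⇒[]=; ≡-dec)
open import Data.Refinement using (Refinement-syntax; _,_; value; value-injective)
open import Data.Irrelevant using ([_])
open import Data.Product.Base using (∃; _×_; _,_; proj₁; proj₂)
open import Data.Sum.Base using (_⊎_; inj₁; inj₂)
open import Function.Base using (flip; _∘_)
open import Function.Bundles using (_⇔_; _↔_; Inverse; mk↔ₛ′)
open import Induction.WellFounded using (Acc; acc)
open import Relation.Binary.Bundles using (Setoid)
open import Relation.Binary.Core using (Rel)
open import Relation.Binary.Structures using (IsDecPartialOrder)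
import Relation.Binary.Construct.Flip.EqAndOrd as Flip
open import Relation.Binary.Construct.Closure.ReflexiveTransitive using (Star; ε; _◅_)
open import Relation.Binary.PropositionalEquality
  using (_≡_; _≢_; refl; sym; trans; cong; subst; setoid; isEquivalence)
open import Relation.Nullary using (yes; no; does; contradiction)
open import Relation.Nullary.Decidable
  using (_×-dec_; _⊎-dec_; _→-dec_; map′; dec-true; recompute; decidable-stable)
open import Relation.Unary using (Pred; Decidable)

module _ {X : Set} where

  Enumerates : List X → Pred X 0ℓ → Set
  Enumerates xs P = Unique xs × (∀ x → x List.∈ xs ⇔ P x)

  HasSize : Pred X 0ℓ → ℕ → Set
  HasSize P k = ∃ λ xs → Enumerates xs P × length xs ≡ k

  -- The sum of w x over all x satisfying P, compared with a rational
  -- number so that quotients in closed formulas are not truncated.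
  HasTotal : (X → ℕ) → Pred X 0ℓ → ℚ → Set
  HasTotal w P q = ∃ λ xs → Enumerates xs P × (+ sum (map w xs)) ℚ./ 1 ≡ q

module _ {X : Set} (f : X ↔ X) where

  open Inverse f using (to; from; strictlyInverseˡ; strictlyInverseʳ)

  power : ℤ → X → X
  power (+ zero)     x = x
  power (+ suc k)    x = to (power (+ k) x)
  power -[1+ zero  ] x = from x
  power -[1+ suc k ] x = from (power -[1+ k ] x)

  Orbit : X → Pred X 0ℓ
  Orbit x y = ∃ λ k → power k x ≡ y

  power-suc : ∀ i x → power (ℤ.suc i) x ≡ to (power i x)
  power-suc (+ k)        x = refl
  power-suc -[1+ zero  ] x = sym (strictlyInverseˡ x)
  power-suc -[1+ suc k ] x = sym (strictlyInverseˡ _)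

  power-pred : ∀ i x → power (ℤ.pred i) x ≡ from (power i x)
  power-pred i x =
    trans (sym (strictlyInverseʳ _))
      (cong from (trans (sym (power-suc (ℤ.pred i) x))
                        (cong (λ j → power j x) (ℤ.suc-pred i))))

  power-+ : ∀ i j x → power (i ℤ.+ j) x ≡ power i (power j x)
  power-+ (+ zero) j x = cong (λ i → power i x) (ℤ.+-identityˡ j)
  power-+ (+ suc k) j x =
    trans (cong (λ i → power i x) (ℤ.suc-+ k j))
      (trans (power-suc (+ k ℤ.+ j) x) (cong to (power-+ (+ k) j x)))
  power-+ -[1+ zero  ] j x = power-pred j x
  power-+ -[1+ suc k ] j x =
    trans (cong (λ i → power i x) (ℤ.pred-+ -[1+ k ] j))
      (trans (power-pred (-[1+ k ] ℤ.+ j) x) (cong from (power-+ -[1+ k ] j x)))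

  orbitSetoid : Setoid 0ℓ 0ℓ
  orbitSetoid = record
    { Carrier       = X
    ; _≈_           = Orbit
    ; isEquivalence = record
      { refl  = + 0 , refl
      ; sym   = λ { {x} (k , refl) → ℤ.- k ,
                  trans (sym (power-+ (ℤ.- k) k x))
                        (cong (λ i → power i x) (ℤ.+-inverseˡ k)) }
      ; trans = λ { {x} (k , refl) (l , refl) → l ℤ.+ k , power-+ l k x }
      }
    }

  HasOrbitCount : ℕ → Set
  HasOrbitCount k = Inverse orbitSetoid (setoid (Fin k))

module _ {n} {P : Pred (Fin n) 0ℓ} (P? : Decidable P) where

  comprehension : Subset n
  comprehension = tabulate (does ∘ P?)

  ∈-comprehension⁺ : ∀ {x} → P x → x ∈ comprehension
  ∈-comprehension⁺ {x} p =
    lookup⇒[]= x _ (trans (lookup∘tabulate _ x) (dec-true (P? x) p))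

  ∈-comprehension⁻ : ∀ {x} → x ∈ comprehension → P x
  ∈-comprehension⁻ {x} x∈ with P? x | trans (sym (lookup∘tabulate (does ∘ P?) x)) ([]=⇒lookup x∈)
  ... | yes p | _  = p
  ... | no  _ | ()

∁-involutive : ∀ {n} (S : Subset n) → ∁ (∁ S) ≡ S
∁-involutive S = ⊆-antisym
  (λ x∈ → x∉∁p⇒x∈p (x∈∁p⇒x∉p x∈))
  (λ x∈ → x∉p⇒x∈∁p (x∈p⇒x∉∁p x∈))

-- The order-dual of every notion here is obtained by instantiating the
-- module with the opposite order.
module Order {n} {_≼_ : Rel (Fin n) 0ℓ} (isDPO : IsDecPartialOrder _≡_ _≼_) where

  open IsDecPartialOrder isDPO
    using (_≟_; isPartialOrder; antisym)
    renaming (refl to ≼-refl; trans to ≼-trans; _≤?_ to _≼?_)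

  IsAntichain : Subset n → Set
  IsAntichain A = ∀ {x y} → x ∈ A → y ∈ A → x ≼ y → x ≡ y

  IsUpperSet : Subset n → Set
  IsUpperSet U = ∀ {x y} → x ∈ U → x ≼ y → y ∈ U

  Above : Subset n → Pred (Fin n) 0ℓ
  Above A x = ∃ λ y → y ∈ A × y ≼ x

  above? : ∀ A → Decidable (Above A)
  above? A x = any? λ y → y ∈? A ×-dec y ≼? x

  ↑ : Subset n → Subset n
  ↑ A = comprehension (above? A)

  Minimal : Subset n → Pred (Fin n) 0ℓ
  Minimal S x = x ∈ S × (∀ y → y ∈ S → y ≼ x → y ≡ x)

  minimal? : ∀ S → Decidable (Minimal S)
  minimal? S x = x ∈? S ×-dec all? λ y → y ∈? S →-dec y ≼? x →-dec y ≟ x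

  min : Subset n → Subset n
  min S = comprehension (minimal? S)

  min-isAntichain : ∀ S → IsAntichain (min S)
  min-isAntichain S {x} x∈ y∈ =
    proj₂ (∈-comprehension⁻ (minimal? S) y∈) x (proj₁ (∈-comprehension⁻ (minimal? S) x∈))

  ↑-isUpperSet : ∀ A → IsUpperSet (↑ A)
  ↑-isUpperSet A x∈ x≼y =
    let z , z∈A , z≼x = ∈-comprehension⁻ (above? A) x∈
    in ∈-comprehension⁺ (above? A) (z , z∈A , ≼-trans z≼x x≼y)

  ↑-min : ∀ {U} → IsUpperSet U → ↑ (min U) ≡ U
  ↑-min {U} up = ⊆-antisym
    (λ x∈ → let y , y∈ , y≼x = ∈-comprehension⁻ (above? (min U)) x∈
            in up (proj₁ (∈-comprehension⁻ (minimal? U) y∈)) y≼x)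
    (λ x∈ → ∈-comprehension⁺ (above? (min U)) (descend (po-wellFounded isPartialOrder _) x∈))
    where
    descend : ∀ {x} → Acc (λ y z → y ≼ z × y ≢ z) x → x ∈ U → Above (min U) x
    descend {x} (acc rs) x∈ with any? (λ y → y ∈? U ×-dec y ≼? x ×-dec (y ≟ x →-dec no λ ()))
    ... | yes (y , y∈ , y≼x , y≢x) =
      let z , z∈ , z≼y = descend (rs (y≼x , y≢x)) y∈ in z , z∈ , ≼-trans z≼y y≼x
    ... | no none = x , ∈-comprehension⁺ (minimal? U) (x∈ , λ y y∈ y≼x →
      decidable-stable (y ≟ x) λ y≢x → none (y , y∈ , y≼x , y≢x)) , ≼-refl

  min-↑ : ∀ {A} → IsAntichain A → min (↑ A) ≡ A
  min-↑ {A} anti = ⊆-antisym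
    (λ x∈ → let x∈↑ , least = ∈-comprehension⁻ (minimal? (↑ A)) x∈
                y , y∈ , y≼x = ∈-comprehension⁻ (above? A) x∈↑
            in subst (_∈ A) (least y (A⊆↑ y∈) y≼x) y∈)
    (λ {x} x∈ → ∈-comprehension⁺ (minimal? (↑ A)) (A⊆↑ x∈ , λ y y∈ y≼x →
       let z , z∈ , z≼y = ∈-comprehension⁻ (above? A) y∈
       in antisym y≼x (subst (_≼ y) (anti z∈ x∈ (≼-trans z≼y y≼x)) z≼y)))
    where
    A⊆↑ : ∀ {x} → x ∈ A → x ∈ ↑ A
    A⊆↑ {x} x∈ = ∈-comprehension⁺ (above? A) (x , x∈ , ≼-refl)

module Rowmotion {n} {_≼_ : Rel (Fin n) 0ℓ} (isDPO : IsDecPartialOrder _≡_ _≼_) where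

  private
    flipped : IsDecPartialOrder _≡_ (flip _≼_)
    flipped = record
      { isPartialOrder = Flip.isPartialOrder (IsDecPartialOrder.isPartialOrder isDPO)
      ; _≟_            = IsDecPartialOrder._≟_ isDPO
      ; _≤?_           = flip (IsDecPartialOrder._≤?_ isDPO)
      }

  open Order isDPO public
    using (IsAntichain; IsUpperSet; ↑; min; min-isAntichain; ↑-isUpperSet; ↑-min; min-↑)
  open Order flipped public
    using ()
    renaming ( IsUpperSet to IsIdeal; ↑ to ↓; min to max; ↑-isUpperSet to ↓-isIdeal
             ; ↑-min to ↓-max; min-↑ to max-↓; min-isAntichain to max-isAntichainᵒᵖ )

  -- Membership proofs are irrelevant, so _≡_ on antichains and on ideals
  -- is equality of the underlying subsets.
  Antichain : Set
  Antichain = [ A ∈ Subset n ∣ IsAntichain A ]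

  Ideal : Set
  Ideal = [ I ∈ Subset n ∣ IsIdeal I ]

  ∅ᴬ : Antichain
  ∅ᴬ = ⊥ , [ (λ x∈ → contradiction x∈ ∉⊥) ]

  ∅ᴵ : Ideal
  ∅ᴵ = ⊥ , [ (λ x∈ → contradiction x∈ ∉⊥) ]

  IsAntichainᵒᵖ : Subset n → Set
  IsAntichainᵒᵖ = Order.IsAntichain flipped

  antichain⇒ᵒᵖ : ∀ {A} → IsAntichain A → IsAntichainᵒᵖ A
  antichain⇒ᵒᵖ anti x∈ y∈ y≼x = sym (anti y∈ x∈ y≼x)

  max-isAntichain : ∀ S → IsAntichain (max S)
  max-isAntichain S x∈ y∈ x≼y = sym (max-isAntichainᵒᵖ S y∈ x∈ x≼y)

  ∁-ideal : ∀ {I} → IsIdeal I → IsUpperSet (∁ I)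
  ∁-ideal ideal x∈ x≼y = x∉p⇒x∈∁p λ y∈ → x∈∁p⇒x∉p x∈ (ideal y∈ x≼y)

  ∁-upperSet : ∀ {U} → IsUpperSet U → IsIdeal (∁ U)
  ∁-upperSet up x∈ y≼x = x∉p⇒x∈∁p λ y∈ → x∈∁p⇒x∉p x∈ (up y∈ y≼x)

  private
    relevant : {S T : Subset n} → .(S ≡ T) → S ≡ T
    relevant {S} {T} = recompute (≡-dec Bool._≟_ S T)

  ρ : Antichain ↔ Antichain
  ρ = mk↔ₛ′
    (λ (A , _) → min (∁ (↓ A)) , [ min-isAntichain (∁ (↓ A)) ])
    (λ (A , _) → max (∁ (↑ A)) , [ max-isAntichain (∁ (↑ A)) ])
    (λ { (A , [ anti ]) → value-injective (relevant
           (trans (cong (min ∘ ∁) (↓-max (∁-upperSet (↑-isUpperSet A))))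
             (trans (cong min (∁-involutive (↑ A))) (min-↑ anti)))) })
    (λ { (A , [ anti ]) → value-injective (relevant
           (trans (cong (max ∘ ∁) (↑-min (∁-ideal (↓-isIdeal A))))
             (trans (cong max (∁-involutive (↓ A))) (max-↓ (antichain⇒ᵒᵖ anti))))) })

  ρ̂ : Ideal ↔ Ideal
  ρ̂ = mk↔ₛ′
    (λ (I , _) → ↓ (min (∁ I)) , [ ↓-isIdeal (min (∁ I)) ])
    (λ (I , _) → ∁ (↑ (max I)) , [ ∁-upperSet (↑-isUpperSet (max I)) ])
    (λ { (I , [ ideal ]) → value-injective (relevant
           (trans (cong (↓ ∘ min) (∁-involutive (↑ (max I))))
             (trans (cong ↓ (min-↑ (max-isAntichain I))) (↓-max ideal)))) })
    (λ { (I , [ ideal ]) → value-injective (relevant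
           (trans (cong (∁ ∘ ↑) (max-↓ (antichain⇒ᵒᵖ (min-isAntichain (∁ I)))))
             (trans (cong ∁ (↑-min (∁-ideal ideal))) (∁-involutive I)))) })

-- The element x_{k+1} is represented by the index k, so that the peak
-- x_a has index a - 1.
module Fence (a b : ℕ) where

  X : Set
  X = Fin (a ℕ.+ b ∸ 1)

  infix 4 _◁_ _⊑_

  data _◁_ : Rel X 0ℓ where
    ascend  : ∀ {i j} → toℕ j ≡ suc (toℕ i) → toℕ j < a → i ◁ j
    descend : ∀ {i j} → toℕ j ≡ suc (toℕ i) → a ≤ toℕ j → j ◁ i

  _⊑_ : Rel X 0ℓ
  _⊑_ = Star _◁_

  -- An explicit description of the order, from which antisymmetry and
  -- decidability are read off.
  _⊑′_ : Rel X 0ℓ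
  i ⊑′ j = (toℕ i ≤ toℕ j × toℕ j < a) ⊎ (toℕ j ≤ toℕ i × a ≤ suc (toℕ j))

  ⊑⇒⊑′ : ∀ {i j} → i ⊑ j → i ⊑′ j
  ⊑⇒⊑′ {i} ε with toℕ i ℕ.<? a
  ... | yes i<a = inj₁ (ℕ.≤-refl , i<a)
  ... | no  i≮a = inj₂ (ℕ.≤-refl , ℕ.m≤n⇒m≤1+n (ℕ.≮⇒≥ i≮a))
  ⊑⇒⊑′ (ascend {i} {j} eq j<a ◅ p) with ⊑⇒⊑′ p
  ... | inj₁ (j≤k , k<a) = inj₁ (ℕ.≤-trans (ℕ.n≤1+n _) (ℕ.≤-trans (ℕ.≤-reflexive (sym eq)) j≤k) , k<a)
  ... | inj₂ (k≤j , a≤1+k) =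
    inj₁ (ℕ.≤-trans (ℕ.n≤1+n _) (ℕ.≤-trans (ℕ.≤-reflexive (sym eq)) (ℕ.≤-pred (ℕ.≤-trans j<a a≤1+k)))
         , ℕ.≤-<-trans k≤j j<a)
  ⊑⇒⊑′ (descend {i} {j} eq a≤j ◅ p) with ⊑⇒⊑′ p
  ... | inj₁ (i≤k , k<a) =
    inj₂ (ℕ.<⇒≤ (ℕ.<-≤-trans k<a a≤j) , ℕ.≤-trans a≤j (subst (_≤ _) (sym eq) (s≤s i≤k)))
  ... | inj₂ (k≤i , a≤1+k) =
    inj₂ (ℕ.≤-trans k≤i (ℕ.≤-trans (ℕ.n≤1+n _) (ℕ.≤-reflexive (sym eq))) , a≤1+k)

  ascending : ∀ k {i j} → k ℕ.+ toℕ i ≡ toℕ j → toℕ j < a → i ⊑ j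
  ascending zero    eq j<a = subst (_ ⊑_) (toℕ-injective eq) ε
  ascending (suc k) {i} {j} eq j<a =
    ascend i′≡ (ℕ.≤-<-trans (subst (_≤ toℕ j) (sym i′≡) 1+i≤j) j<a)
      ◅ ascending k (trans (cong (k ℕ.+_) i′≡) (trans (ℕ.+-suc k (toℕ i)) eq)) j<a
    where
    1+i≤j : suc (toℕ i) ≤ toℕ j
    1+i≤j = subst (suc (toℕ i) ≤_) eq (s≤s (ℕ.m≤n+m (toℕ i) k))
    i′≡ : toℕ (fromℕ< (ℕ.≤-<-trans 1+i≤j (toℕ<n j))) ≡ suc (toℕ i)
    i′≡ = toℕ-fromℕ< _

  descending : ∀ k {i j} → k ℕ.+ toℕ j ≡ toℕ i → a ≤ suc (toℕ j) → i ⊑ j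
  descending zero    eq a≤1+j = subst (_⊑ _) (toℕ-injective eq) ε
  descending (suc k) {i} {j} eq a≤1+j =
    descend (trans (sym eq) (cong suc (sym i′≡)))
            (ℕ.≤-trans a≤1+j (subst (suc (toℕ j) ≤_) eq (s≤s (ℕ.m≤n+m (toℕ j) k))))
      ◅ descending k (sym i′≡) a≤1+j
    where
    i′≡ : toℕ (fromℕ< (ℕ.≤-trans (ℕ.≤-reflexive eq) (ℕ.<⇒≤ (toℕ<n i)))) ≡ k ℕ.+ toℕ j
    i′≡ = toℕ-fromℕ< _

  ⊑′⇒⊑ : ∀ {i j} → i ⊑′ j → i ⊑ j
  ⊑′⇒⊑ (inj₁ (i≤j , j<a))   = ascending _ (ℕ.m∸n+n≡m i≤j) j<a
  ⊑′⇒⊑ (inj₂ (j≤i , a≤1+j)) = descending _ (ℕ.m∸n+n≡m j≤i) a≤1+j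

  ⊑′-antisym : ∀ {i j} → i ⊑′ j → j ⊑′ i → i ≡ j
  ⊑′-antisym p q = toℕ-injective (go p q)
    where
    go : ∀ {i j} → i ⊑′ j → j ⊑′ i → toℕ i ≡ toℕ j
    go (inj₁ (i≤j , _))   (inj₁ (j≤i , _))   = ℕ.≤-antisym i≤j j≤i
    go (inj₁ (i≤j , j<a)) (inj₂ (_ , a≤1+i)) = ℕ.≤-antisym i≤j (ℕ.≤-pred (ℕ.≤-trans j<a a≤1+i))
    go (inj₂ (j≤i , a≤1+j)) (inj₁ (_ , i<a)) = ℕ.≤-antisym (ℕ.≤-pred (ℕ.≤-trans i<a a≤1+j)) j≤i
    go (inj₂ (j≤i , _))   (inj₂ (i≤j , _))   = ℕ.≤-antisym i≤j j≤i

  ⊑-isDecPartialOrder : IsDecPartialOrder _≡_ _⊑_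
  ⊑-isDecPartialOrder = record
    { isPartialOrder = record
      { isPreorder = record
        { isEquivalence = isEquivalence
        ; reflexive     = λ { refl → ε }
        ; trans         = _◅◅_
        }
      ; antisym = λ p q → ⊑′-antisym (⊑⇒⊑′ p) (⊑⇒⊑′ q)
      }
    ; _≟_  = _≟_
    ; _≤?_ = λ i j → map′ ⊑′⇒⊑ ⊑⇒⊑′
        ((toℕ i ℕ.≤? toℕ j ×-dec toℕ j ℕ.<? a) ⊎-dec (toℕ j ℕ.≤? toℕ i ×-dec a ℕ.≤? suc (toℕ j)))
    }
    where
    open import Data.Fin.Properties using (_≟_)
    open import Relation.Binary.Construct.Closure.ReflexiveTransitive using (_◅◅_)

  open Rowmotion ⊑-isDecPartialOrder public

gcd-nonZero : ∀ {a} b → 2 ≤ a → NonZero (gcd a b)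
gcd-nonZero {suc a} b _ = ≢-nonZero (gcd[m,n]≢0 (suc a) b (inj₁ λ ()))

{-# OPTIONS --safe #-}

-- An ideal of F̆(a,b) other than the whole poset is determined by the
-- numbers i < a and j < b of its elements left and right of the peak.  On
-- these pairs rowmotion is translation by (1 , 1) in ℤ/a × ℤ/b, except that
-- the whole poset is visited between (a - 1 , b - 1) and (0 , 0).  The
-- translation has orbits of length lcm(a,b), told apart by i - j modulo
-- gcd(a,b).  Both statistics are a function of i plus a function of j, and an
-- orbit meets each residue modulo a, and modulo b, equally often.
module Submission where

open import Level using (0ℓ)
open import Data.Bool.Base using (Bool; true; false; if_then_else_)
import Data.Bool.Properties as Bool
open import Data.Nat.Base as ℕ
  using (ℕ; zero; suc; pred; _≤_; _<_; _+_; _*_; _∸_; NonZero; z≤n; s≤s; z<s; s<s; s≤s⁻¹)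
open import Data.Nat.DivMod
open import Data.Nat.Divisibility
open import Data.Nat.GCD using (gcd; gcd-comm; gcd-GCD; gcd[m,n]∣m; gcd[m,n]∣n; gcd[m,n]≢0; module Bézout)
open import Data.Nat.LCM using (lcm; lcm-comm; m∣lcm[m,n]; n∣lcm[m,n]; lcm-least; gcd*lcm)
open import Data.Nat.ListAction using (sum)
open import Data.Nat.Properties
open import Data.Nat.Tactic.RingSolver using (solve-∀)
open import Data.Integer.Base as ℤ using (ℤ; +_; -[1+_])
import Data.Integer.Properties as ℤ
open import Data.Rational.Base as ℚ using (ℚ; 1ℚ; toℚᵘ)
import Data.Rational.Properties as ℚ
open import Data.Rational.Unnormalised.Base as ℚᵘ using (mkℚᵘ; *≡*)
import Data.Rational.Unnormalised.Properties as ℚᵘ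
open import Data.Fin.Base using (Fin; toℕ; fromℕ<)
open import Data.Fin.Properties using (toℕ-injective; toℕ-fromℕ<; toℕ<n; any?; all?)
open import Data.Fin.Subset using (Subset; ∁; ⊤; ⊥; ⁅_⁆; ∣_∣; _∈_; _∉_)
open import Data.Fin.Subset.Properties
  using (_∈?_; ⊆-antisym; ∈⊤; ∉⊥; x∈∁p⇒x∉p; x∉p⇒x∈∁p; x∈⁅x⁆; x∈⁅y⁆⇒x≡y; ∣⊤∣≡n; ∣⁅x⁆∣≡1)
open import Data.Irrelevant using ([_])
open import Data.List.Base using (length; applyUpTo)
import Data.List.Membership.Propositional as List
open import Data.List.Membership.Propositional.Properties using (∈-applyUpTo⁺; ∈-applyUpTo⁻)
open import Data.List.Membership.Propositional.Properties.WithK using (unique∧set⇒bag)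
open import Data.List.Properties using (length-applyUpTo; map-applyUpTo)
open import Data.List.Relation.Binary.BagAndSetEquality using (∼bag⇒↭)
open import Data.List.Relation.Binary.Permutation.Propositional.Properties using (↭-length)
open import Data.List.Relation.Unary.Unique.Propositional.Properties using (applyUpTo⁺₁)
open import Data.Product.Base using (∃; ∃₂; _×_; _,_; proj₁; proj₂; uncurry)
open import Data.Refinement using (_,_; value; value-injective)
open import Data.Sum.Base using (_⊎_; inj₁; inj₂)
open import Data.Vec.Base using (tabulate)
open import Data.Vec.Properties using (≡-dec)
open import Function.Base using (_∘_)
open import Function.Bundles using (_⇔_; _↔_; Equivalence; Inverse; mk⇔)
open import Function.Properties.Equivalence using () renaming (sym to ⇔-sym; trans to ⇔-trans)
open import Relation.Binary.Bundles using (Setoid)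
open import Relation.Binary.Definitions using (tri<; tri≈; tri>)
open import Relation.Binary.PropositionalEquality
open import Relation.Binary.Structures using (IsDecPartialOrder)
open import Relation.Nullary using (¬_; contradiction; yes; no; does)
open import Relation.Nullary.Decidable
  using (_×-dec_; _⊎-dec_; _→-dec_; map′; recompute; dec-true; dec-false)
open import Relation.Unary using (Pred; Decidable)
open import Defs

-- Sums over initial segments of ℕ

-- Left of the peak, the missing element of index i is minimal in the complement and generates a
-- segment of length i + 1. If i = a - 1, the next candidate is the peak, which is not minimal while
-- the right chain has a gap; the left side then contributes no generator and restarts at 0. Only
-- when both chains are full is the peak minimal, hence the detour. The corner before the detour has
-- i - j divisible by the gcd, so only the orbit of the empty set gains a member: an antichain of
-- size 1, or the whole poset of size (a + b - 2) + 1. Each residue modulo a occurs ℓ / a = b / gcd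
-- times in ℓ consecutive translates. An antichain has one element per nonempty side, which gives (b
-- (a - 1) + a (b - 1)) / gcd; an ideal has i + j elements, which gives ℓ (a - 1) / 2 + ℓ (b - 1) /
-- 2. The orbit analysis is done once for an abstract system with unreduced natural indices, and
-- then applied to ideals and to antichains.

sumTo : (ℕ → ℕ) → ℕ → ℕ
sumTo h n = sum (applyUpTo h n)

sumTo-cong : ∀ {h h′} n → (∀ {k} → k < n → h k ≡ h′ k) → sumTo h n ≡ sumTo h′ n
sumTo-cong zero    h≗h′ = refl
sumTo-cong (suc n) h≗h′ = cong₂ _+_ (h≗h′ z<s) (sumTo-cong n (h≗h′ ∘ s<s))

sumTo-const : ∀ c n → sumTo (λ _ → c) n ≡ n * c
sumTo-const c zero    = refl
sumTo-const c (suc n) = cong (c ℕ.+_) (sumTo-const c n)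

sumTo-+ : ∀ h h′ n → sumTo (λ k → h k + h′ k) n ≡ sumTo h n + sumTo h′ n
sumTo-+ h h′ zero    = refl
sumTo-+ h h′ (suc n) = begin
  h 0 + h′ 0 + sumTo (λ k → h (suc k) + h′ (suc k)) n
    ≡⟨ cong (h 0 + h′ 0 ℕ.+_) (sumTo-+ (h ∘ suc) (h′ ∘ suc) n) ⟩
  h 0 + h′ 0 + (sumTo (h ∘ suc) n + sumTo (h′ ∘ suc) n)
    ≡⟨ interchange (h 0) (h′ 0) _ _ ⟩
  h 0 + sumTo (h ∘ suc) n + (h′ 0 + sumTo (h′ ∘ suc) n)
    ∎
  where
  open ≡-Reasoning
  interchange : ∀ x y z w → x + y + (z + w) ≡ x + z + (y + w)
  interchange = solve-∀

sumTo-split : ∀ h m n → sumTo h (m + n) ≡ sumTo h m + sumTo (λ k → h (m + k)) n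
sumTo-split h zero    n = refl
sumTo-split h (suc m) n =
  trans (cong (h 0 ℕ.+_) (sumTo-split (h ∘ suc) m n)) (sym (+-assoc (h 0) _ _))

sumTo-last : ∀ h n → sumTo h (suc n) ≡ sumTo h n + h n
sumTo-last h zero    = +-comm (h 0) 0
sumTo-last h (suc n) = trans (cong (h 0 ℕ.+_) (sumTo-last (h ∘ suc) n)) (sym (+-assoc (h 0) _ _))

sumTo-id : ∀ n → 2 * sumTo (λ k → k) (suc n) ≡ n * suc n
sumTo-id zero    = refl
sumTo-id (suc n) = begin
  2 * sumTo (λ k → k) (suc (suc n))      ≡⟨ cong (2 *_) (sumTo-last (λ k → k) (suc n)) ⟩
  2 * (sumTo (λ k → k) (suc n) + suc n)  ≡⟨ *-distribˡ-+ 2 (sumTo (λ k → k) (suc n)) (suc n) ⟩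
  2 * sumTo (λ k → k) (suc n) + 2 * suc n ≡⟨ cong (_+ 2 * suc n) (sumTo-id n) ⟩
  n * suc n + 2 * suc n                  ≡⟨ gauss n ⟩
  suc n * suc (suc n)                    ∎
  where
  open ≡-Reasoning
  gauss : ∀ n → n * suc n + 2 * suc n ≡ suc n * suc (suc n)
  gauss = solve-∀

module _ (h : ℕ → ℕ) (p : ℕ) (periodic : ∀ k → h (k + p) ≡ h k) where

  -- The windows at `s` and `suc s` arise from the window of length `suc p` at `s` by dropping its
  -- last or its first term, and periodicity equates these two terms.
  sumTo-shift : ∀ s → sumTo (λ k → h (s + k)) p ≡ sumTo h p
  sumTo-shift zero    = refl
  sumTo-shift (suc s) = trans (+-cancelˡ-≡ (h s) _ _ (begin
    h s + sumTo (λ k → h (suc (s + k))) p       ≡⟨ cong₂ _+_ (cong h (sym (+-identityʳ s)))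
                                                     (sumTo-cong p λ {k} _ → cong h (sym (+-suc s k))) ⟩
    sumTo (λ k → h (s + k)) (suc p)             ≡⟨ sumTo-last (λ k → h (s + k)) p ⟩
    sumTo (λ k → h (s + k)) p + h (s + p)       ≡⟨ cong (sumTo (λ k → h (s + k)) p ℕ.+_) (periodic s) ⟩
    sumTo (λ k → h (s + k)) p + h s             ≡⟨ +-comm _ (h s) ⟩
    h s + sumTo (λ k → h (s + k)) p             ∎)) (sumTo-shift s)
    where open ≡-Reasoning

  sumTo-periodic : ∀ q s → sumTo (λ k → h (s + k)) (q * p) ≡ q * sumTo h p
  sumTo-periodic zero    s = refl
  sumTo-periodic (suc q) s = begin
    sumTo (λ k → h (s + k)) (p + q * p)
      ≡⟨ sumTo-split (λ k → h (s + k)) p (q * p) ⟩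
    sumTo (λ k → h (s + k)) p + sumTo (λ k → h (s + (p + k))) (q * p)
      ≡⟨ cong₂ _+_ (sumTo-shift s) (sumTo-cong (q * p) λ {k} _ → cong h (sym (+-assoc s p k))) ⟩
    sumTo h p + sumTo (λ k → h (s + p + k)) (q * p)
      ≡⟨ cong (sumTo h p ℕ.+_) (sumTo-periodic q (s + p)) ⟩
    sumTo h p + q * sumTo h p
      ∎
    where open ≡-Reasoning

-- Evaluates the contribution of one coordinate to a statistic: along the translation it runs
-- through all residues `q` times, wherever it starts.
sumTo-% : ∀ w p .{{_ : NonZero p}} q s → sumTo (λ k → w ((s + k) % p)) (q * p) ≡ q * sumTo w p
sumTo-% w p q s = trans
  (sumTo-periodic (λ k → w (k % p)) p (λ k → cong w ([m+n]%n≡m%n k p)) q s)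
  (cong (q *_) (sumTo-cong p λ k<p → cong w (m<n⇒m%n≡m k<p)))

-- Counts the maximal elements of an initial segment of given length in a chain.
sgn : ℕ → ℕ
sgn zero    = 0
sgn (suc _) = 1

sumTo-sgn : ∀ n → sumTo sgn (suc n) ≡ n
sumTo-sgn n = trans (sumTo-const 1 n) (*-identityʳ n)

indicator : Bool → ℕ
indicator b = if b then 1 else 0

∣tabulate∣ : ∀ (p : ℕ → Bool) n → ∣ tabulate {n = n} (p ∘ toℕ) ∣ ≡ sumTo (indicator ∘ p) n
∣tabulate∣ p zero = refl
∣tabulate∣ p (suc n) with p 0
... | true  = cong suc (∣tabulate∣ (p ∘ suc) n)
... | false = ∣tabulate∣ (p ∘ suc) n

module _ {P : Pred ℕ 0ℓ} (P? : Decidable P) where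

  sumTo-all : ∀ n → (∀ {k} → k < n → P k) → sumTo (indicator ∘ does ∘ P?) n ≡ n
  sumTo-all n all = begin
    sumTo (indicator ∘ does ∘ P?) n ≡⟨ sumTo-cong n (λ {k} k<n → cong indicator (dec-true (P? k) (all k<n))) ⟩
    sumTo (λ _ → 1) n ≡⟨ sumTo-const 1 n ⟩
    n * 1 ≡⟨ *-identityʳ n ⟩
    n ∎
    where open ≡-Reasoning

  sumTo-none : ∀ n → (∀ {k} → k < n → ¬ P k) → sumTo (indicator ∘ does ∘ P?) n ≡ 0
  sumTo-none n none = begin
    sumTo (indicator ∘ does ∘ P?) n ≡⟨ sumTo-cong n (λ {k} k<n → cong indicator (dec-false (P? k) (none k<n))) ⟩
    sumTo (λ _ → 0) n ≡⟨ sumTo-const 0 n ⟩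
    n * 0 ≡⟨ *-zeroʳ n ⟩
    0 ∎
    where open ≡-Reasoning

  sumTo-last-only : ∀ n → P n → (∀ {k} → k < n → ¬ P k) → sumTo (indicator ∘ does ∘ P?) (suc n) ≡ 1
  sumTo-last-only n p none = trans (sumTo-last _ n)
    (cong₂ _+_ (sumTo-none n none) (cong indicator (dec-true (P? n) p)))

sumTo-first-only : {P : Pred ℕ 0ℓ} (P? : Decidable P) → ∀ n → P 0 → (∀ {k} → k < n → ¬ P (suc k)) →
  sumTo (indicator ∘ does ∘ P?) (suc n) ≡ 1
sumTo-first-only P? n p none =
  cong₂ _+_ (cong indicator (dec-true (P? 0) p)) (sumTo-none (P? ∘ suc) n none)

-- Orbits of bijections

module _ {X : Set} {P : Pred X 0ℓ} where

  enumerates-length : ∀ {xs ys} → Enumerates xs P → Enumerates ys P → length xs ≡ length ys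
  enumerates-length (uxs , xs⇔P) (uys , ys⇔P) =
    ↭-length (∼bag⇒↭ (unique∧set⇒bag uxs uys λ {x} → ⇔-trans (xs⇔P x) (⇔-sym (ys⇔P x))))

  -- Lets a hypothesis on the size of an orbit decide which kind of orbit it is.
  hasSize-unique : ∀ {m n} → HasSize P m → HasSize P n → m ≡ n
  hasSize-unique (_ , e , refl) (_ , e′ , refl) = enumerates-length e e′

module _ {X : Set} (f : X ↔ X) where

  open Inverse f using (to; from; strictlyInverseʳ)
  open Setoid (orbitSetoid f) using () renaming (refl to ~-refl; sym to ~-sym; trans to ~-trans)

  orbit-to : ∀ {x y} → to x ≡ y → Orbit f x y
  orbit-to eq = + 1 , eq

  orbit-closed : ∀ {P : Pred X 0ℓ} → (∀ {x} → P x → P (to x)) → (∀ {x} → P x → P (from x)) →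
    ∀ {x y} → Orbit f x y → P x → P y
  orbit-closed {P} P-to P-from {x} (k , refl) p = go k
    where
    go : ∀ k → P (power f k x)
    go (+ zero)     = p
    go (+ suc k)    = P-to (go (+ k))
    go -[1+ zero  ] = P-from p
    go -[1+ suc k ] = P-from (go -[1+ k ])

  orbit-invariant : ∀ {Y : Set} (φ : X → Y) → (∀ x → φ (to x) ≡ φ x) →
    ∀ {x y} → Orbit f x y → φ x ≡ φ y
  orbit-invariant φ inv {x} x~y = orbit-closed {P = λ z → φ x ≡ φ z}
    (λ {z} eq → trans eq (sym (inv z)))
    (λ {z} eq → trans eq (trans (cong φ (sym (Inverse.strictlyInverseˡ f z))) (inv (from z))))
    x~y refl

  enumerates-orbit : ∀ {x y xs} → Orbit f x y → Enumerates xs (Orbit f x) → Enumerates xs (Orbit f y)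
  enumerates-orbit x~y (u , xs⇔) = u , λ z → mk⇔
    (~-trans (~-sym x~y) ∘ Equivalence.to (xs⇔ z))
    (Equivalence.from (xs⇔ z) ∘ ~-trans x~y)

  -- Indexed by the last position instead of the length, so that a cycle is nonempty and its closing
  -- step needs no predecessor.
  record Cycle (c : ℕ → X) (p-1 : ℕ) : Set where
    field
      next     : ∀ {k} → k < p-1 → to (c k) ≡ c (suc k)
      close    : to (c p-1) ≡ c 0
      distinct : ∀ {k l} → k < l → l ≤ p-1 → c k ≢ c l

    enumerates : Enumerates (applyUpTo c (suc p-1)) (Orbit f (c 0))
    enumerates = applyUpTo⁺₁ c (suc p-1) (λ k<l l<p → distinct k<l (ℕ.s≤s⁻¹ l<p)) , λ x → mk⇔
      (λ x∈ → let k , k<p , x≡ck = ∈-applyUpTo⁻ c x∈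
              in subst (Orbit f (c 0)) (sym x≡ck) (reach k (ℕ.s≤s⁻¹ k<p)))
      (λ c0~x → let k , k<p , x≡ck = orbit-closed {P = OnCycle} stays-to stays-from c0~x (0 , z≤n , refl)
                in subst (λ x → x List.∈ applyUpTo c (suc p-1)) (sym x≡ck) (∈-applyUpTo⁺ c (s≤s k<p)))
      where
      reach : ∀ k → k ≤ p-1 → Orbit f (c 0) (c k)
      reach zero    _   = ~-refl
      reach (suc k) k<p = ~-trans (reach k (<⇒≤ k<p)) (orbit-to (next k<p))
      OnCycle : Pred X 0ℓ
      OnCycle x = ∃ λ k → k ≤ p-1 × x ≡ c k
      stays-to : ∀ {x} → OnCycle x → OnCycle (to x)
      stays-to (k , k≤p-1 , refl) with m≤n⇒m<n∨m≡n k≤p-1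
      ... | inj₁ k<p-1 = suc k , k<p-1 , next k<p-1
      ... | inj₂ refl  = 0 , z≤n , close
      stays-from : ∀ {x} → OnCycle x → OnCycle (from x)
      stays-from (zero  , _   , refl) = p-1 , ≤-refl , trans (cong from (sym close)) (strictlyInverseʳ _)
      stays-from (suc k , k<p , refl) = k , <⇒≤ k<p , trans (cong from (sym (next k<p))) (strictlyInverseʳ _)

-- Translations with one extra point

[m+k]%n≡m%n⇒n∣k : ∀ m k n .{{_ : NonZero n}} → (m + k) % n ≡ m % n → n ∣ k
[m+k]%n≡m%n⇒n∣k m k n eq = ∣m+n∣m⇒∣n
  (divides ((m + k) / n) (+-cancelˡ-≡ (m % n) _ _ (begin
    m % n + (m / n * n + k)             ≡⟨ +-assoc (m % n) _ k ⟨
    m % n + m / n * n + k               ≡⟨ cong (_+ k) (m≡m%n+[m/n]*n m n) ⟨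
    m + k                               ≡⟨ m≡m%n+[m/n]*n (m + k) n ⟩
    (m + k) % n + (m + k) / n * n       ≡⟨ cong (_+ (m + k) / n * n) eq ⟩
    m % n + (m + k) / n * n             ∎)))
  (divides (m / n) refl)
  where open ≡-Reasoning

%-cong-+* : ∀ {m m′ n n′} c d .{{_ : NonZero d}} → m % d ≡ m′ % d → n % d ≡ n′ % d →
  (m + c * n) % d ≡ (m′ + c * n′) % d
%-cong-+* {m} {m′} {n} {n′} c d m≡m′ n≡n′ = begin
  (m + c * n) % d                       ≡⟨ %-distribˡ-+ m (c * n) d ⟩
  (m % d + (c * n) % d) % d             ≡⟨ cong₂ (λ x y → (x + y) % d) m≡m′ c*n≡c*n′ ⟩
  (m′ % d + (c * n′) % d) % d           ≡⟨ %-distribˡ-+ m′ (c * n′) d ⟨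
  (m′ + c * n′) % d                     ∎
  where
  open ≡-Reasoning
  c*n≡c*n′ : (c * n) % d ≡ (c * n′) % d
  c*n≡c*n′ = trans (%-distribˡ-* c n d)
    (trans (cong (λ x → (c % d * x) % d) n≡n′) (sym (%-distribˡ-* c n′ d)))

%-≡-∣ : ∀ {m n d k} .{{_ : NonZero d}} .{{_ : NonZero k}} → d ∣ k → m % k ≡ n % k → m % d ≡ n % d
%-≡-∣ {m} {n} {d} {k} d∣k eq =
  trans (sym (m∣n⇒o%n%m≡o%m d k m d∣k)) (trans (cong (_% d) eq) (m∣n⇒o%n%m≡o%m d k n d∣k))

-- A bijection of the torus ℤ/a × ℤ/b with one extra point inserted into
-- the translation by (1 , 1), between (-1 , -1) and (0 , 0).
record PuncturedTranslation {X : Set} (f : X ↔ X) (a b : ℕ) .{{_ : NonZero a}} .{{_ : NonZero b}} : Set where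
  open Inverse f using (to)
  field
    D           : ℕ → ℕ → X
    top         : X
    D-cong      : ∀ {i i′ j j′} → i % a ≡ i′ % a → j % b ≡ j′ % b → D i j ≡ D i′ j′
    D-injective : ∀ {i i′ j j′} → D i j ≡ D i′ j′ → i % a ≡ i′ % a × j % b ≡ j′ % b
    D≢top       : ∀ {i j} → D i j ≢ top
    view        : ∀ x → x ≡ top ⊎ ∃₂ λ i j → x ≡ D i j
    to-D        : ∀ {i j} → ¬ ((a ∣ suc i) × (b ∣ suc j)) → to (D i j) ≡ D (suc i) (suc j)
    to-corner   : ∀ {i j} → a ∣ suc i → b ∣ suc j → to (D i j) ≡ top
    to-top      : to top ≡ D 0 0

module _ {X : Set} {f : X ↔ X} {a b : ℕ} .{{_ : NonZero a}} .{{_ : NonZero b}}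
         (system : PuncturedTranslation f a b) where

  open PuncturedTranslation system
  open Inverse f using (to)
  open Setoid (orbitSetoid f)
    using (_≈_)
    renaming (refl to ~-refl; sym to ~-sym; trans to ~-trans; reflexive to ~-reflexive)

  private
    g ℓ : ℕ
    g = gcd a b
    ℓ = lcm a b

    g∣a : g ∣ a
    g∣a = gcd[m,n]∣m a b

    g∣b : g ∣ b
    g∣b = gcd[m,n]∣n a b

    instance
      g≢0 : NonZero g
      g≢0 = ℕ.≢-nonZero (gcd[m,n]≢0 a b (inj₁ (ℕ.≢-nonZero⁻¹ a)))

      ℓ≢0 : NonZero ℓ
      ℓ≢0 = ℕ.≢-nonZero λ ℓ≡0 → ℕ.≢-nonZero⁻¹ (a * b) {{m*n≢0 a b}}
        (trans (sym (gcd*lcm a b)) (trans (cong (g *_) ℓ≡0) (*-zeroʳ g)))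

    suc-pred-ℓ : suc (pred ℓ) ≡ ℓ
    suc-pred-ℓ = suc-pred ℓ

  -- Moves within an orbit and the invariant that labels orbits

  D-period : ∀ {i j k} → a ∣ k → b ∣ k → D (i + k) (j + k) ≡ D i j
  D-period {i} {j} a∣k b∣k = D-cong (%-remove-+ʳ i a∣k) (%-remove-+ʳ j b∣k)

  -- A coincidence makes both `a` and `b`, hence their lcm, divide `l ∸ k`, which is positive and
  -- less than `ℓ`.
  D-distinct : ∀ i j {k l} → k < l → l < ℓ → D (i + k) (j + k) ≢ D (i + l) (j + l)
  D-distinct i j {k} {l} k<l l<ℓ eq = >⇒∤ {{ℕ.>-nonZero (m<n⇒0<n∸m k<l)}} l-k<ℓ (lcm-least
      ([m+k]%n≡m%n⇒n∣k (i + k) (l ∸ k) a (trans (cong (_% a) (split i)) (sym (proj₁ (D-injective eq)))))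
      ([m+k]%n≡m%n⇒n∣k (j + k) (l ∸ k) b (trans (cong (_% b) (split j)) (sym (proj₂ (D-injective eq))))))
    where
    l-k<ℓ : l ∸ k < ℓ
    l-k<ℓ = ≤-<-trans (m∸n≤m l k) l<ℓ
    split : ∀ i → i + k + (l ∸ k) ≡ i + l
    split i = trans (+-assoc i k _) (cong (_+_ i) (m+[n∸m]≡n (<⇒≤ k<l)))

  -- At the corner this takes two applications of the bijection, by way of `top`; so translation by
  -- (1 , 1) stays within an orbit everywhere.
  D-step : ∀ i j → D i j ≈ D (suc i) (suc j)
  D-step i j with a ∣? suc i ×-dec b ∣? suc j
  ... | no ¬corner = orbit-to f (to-D ¬corner)
  ... | yes (a∣1+i , b∣1+j) = ~-trans (orbit-to f (to-corner a∣1+i b∣1+j))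
    (orbit-to f (trans to-top (D-cong (sym (%-remove-+ʳ 0 a∣1+i)) (sym (%-remove-+ʳ 0 b∣1+j)))))

  D-slide : ∀ i j k → D i j ≈ D (i + k) (j + k)
  D-slide i j zero    = ~-reflexive (sym (cong₂ D (+-identityʳ i) (+-identityʳ j)))
  D-slide i j (suc k) = ~-trans (D-step i j)
    (~-trans (D-slide (suc i) (suc j) k) (~-reflexive (sym (cong₂ D (+-suc i k) (+-suc j k)))))

  -- Sliding `pred b * j` times acts on the second coordinate as subtraction of `j`, since j + (b -
  -- 1) j is a multiple of `b`.
  D-axis : ∀ i j → D i j ≈ D (i + pred b * j) 0
  D-axis i j = ~-trans (D-slide i j (pred b * j)) (~-reflexive (D-cong refl (begin
    (j + pred b * j) % b   ≡⟨ cong (λ x → (x * j) % b) (suc-pred b) ⟩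
    (b * j) % b            ≡⟨ cong (_% b) (*-comm b j) ⟩
    (j * b) % b            ≡⟨ m*n%n≡0 j b ⟩
    0                      ≡⟨ m*n%n≡0 0 b ⟨
    0 % b                  ∎)))
    where open ≡-Reasoning

  -- By Bézout some multiple of `b` is congruent to `g` or to its negative modulo `a`, and sliding
  -- by it fixes the second coordinate. In the negative case the slide starts from `i + g`.
  D-+gcd : ∀ i → D i 0 ≈ D (i + g) 0
  D-+gcd i with Bézout.identity (gcd-GCD a b)
  ... | Bézout.-+ x y g+xa≡yb = ~-trans (D-slide i 0 (y * b)) (~-reflexive (D-cong
    (trans (cong (_% a) (trans (cong (_+_ i) (sym g+xa≡yb)) (sym (+-assoc i g _)))) ([m+kn]%n≡m%n (i + g) x a))
    ([m+kn]%n≡m%n 0 y b)))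
  ... | Bézout.+- x y g+yb≡xa = ~-sym (~-trans (D-slide (i + g) 0 (y * b)) (~-reflexive (D-cong
    (trans (cong (_% a) (trans (+-assoc i g _) (cong (_+_ i) g+yb≡xa))) ([m+kn]%n≡m%n i x a))
    ([m+kn]%n≡m%n 0 y b))))

  D-+gcd* : ∀ i k → D i 0 ≈ D (i + k * g) 0
  D-+gcd* i zero    = ~-reflexive (cong (λ x → D x 0) (sym (+-identityʳ i)))
  D-+gcd* i (suc k) = ~-trans (D-+gcd i)
    (~-trans (D-+gcd* (i + g) k) (~-reflexive (cong (λ x → D x 0) (+-assoc i g (k * g)))))

  -- ℤ/a × ℤ/b modulo (1 , 1) is ℤ/g through i - j, written i + (b - 1) j.
  label : ℕ → ℕ → Fin g
  label i j = (i + pred b * j) mod g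

  label-cong : ∀ {i i′ j j′} → i % a ≡ i′ % a → j % b ≡ j′ % b → label i j ≡ label i′ j′
  label-cong {i} {i′} i≡i′ j≡j′ = toℕ-injective (begin
    toℕ (label i _)   ≡⟨ toℕ-fromℕ< _ ⟩
    _                 ≡⟨ %-cong-+* (pred b) g (%-≡-∣ {m = i} {n = i′} g∣a i≡i′) (%-≡-∣ g∣b j≡j′) ⟩
    _                 ≡⟨ toℕ-fromℕ< _ ⟨
    toℕ (label i′ _)  ∎)
    where open ≡-Reasoning

  -- The argument grows by 1 + (b - 1) = b, a multiple of `g`.
  label-step : ∀ i j → label (suc i) (suc j) ≡ label i j
  label-step i j = toℕ-injective (begin
    toℕ (label (suc i) (suc j))         ≡⟨ toℕ-fromℕ< _ ⟩
    (suc i + pred b * suc j) % g        ≡⟨ cong (_% g) (regroup i (pred b) j) ⟩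
    (i + pred b * j + suc (pred b)) % g ≡⟨ cong (λ x → (i + pred b * j + x) % g) (suc-pred b) ⟩
    (i + pred b * j + b) % g            ≡⟨ %-remove-+ʳ (i + pred b * j) g∣b ⟩
    (i + pred b * j) % g                ≡⟨ toℕ-fromℕ< _ ⟨
    toℕ (label i j)                     ∎)
    where
    open ≡-Reasoning
    regroup : ∀ i b j → suc i + b * suc j ≡ i + b * j + suc b
    regroup = solve-∀

  class : X → Fin g
  class x with view x
  -- By `to-top` the extra point shares the orbit of `D 0 0`.
  ... | inj₁ _           = label 0 0
  ... | inj₂ (i , j , _) = label i j

  class-top : class top ≡ label 0 0
  class-top with view top
  ... | inj₁ _              = refl
  ... | inj₂ (_ , _ , top≡D) = contradiction (sym top≡D) D≢top

  -- `view` may return other indices for the same point; injectivity of `D` makes the labels agree.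
  class-D : ∀ i j → class (D i j) ≡ label i j
  class-D i j with view (D i j)
  ... | inj₁ D≡top           = contradiction D≡top D≢top
  ... | inj₂ (i′ , j′ , D≡D′) = sym (uncurry label-cong (D-injective D≡D′))

  class-invariant : ∀ x → class (to x) ≡ class x
  class-invariant x with view x
  ... | inj₁ refl = trans (cong class to-top) (class-D 0 0)
  ... | inj₂ (i , j , refl) with a ∣? suc i ×-dec b ∣? suc j
  ...   | no ¬corner = trans (cong class (to-D ¬corner)) (trans (class-D (suc i) (suc j)) (label-step i j))
  -- One step past the corner both indices vanish modulo `a` and `b`, so the label is that of (0 ,
  -- 0).
  ...   | yes (a∣1+i , b∣1+j) = trans (cong class (to-corner a∣1+i b∣1+j)) (trans class-top
    (trans (label-cong (sym (%-remove-+ʳ 0 a∣1+i)) (sym (%-remove-+ʳ 0 b∣1+j))) (label-step i j)))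

  representative : Fin g → X
  representative s = D (toℕ s) 0

  label-representative : ∀ s → label (toℕ s) 0 ≡ s
  label-representative s = toℕ-injective (begin
    toℕ (label (toℕ s) 0)        ≡⟨ toℕ-fromℕ< _ ⟩
    (toℕ s + pred b * 0) % g     ≡⟨ cong (λ x → (toℕ s + x) % g) (*-zeroʳ (pred b)) ⟩
    (toℕ s + 0) % g              ≡⟨ cong (_% g) (+-identityʳ (toℕ s)) ⟩
    toℕ s % g                    ≡⟨ m<n⇒m%n≡m (toℕ<n s) ⟩
    toℕ s                        ∎)
    where open ≡-Reasoning

  -- Sliding onto the axis produces the very number whose residue is the label, and moves by `g`
  -- along the axis reduce it. So the label is a complete invariant.
  D~representative : ∀ i j → D i j ≈ representative (label i j)
  D~representative i j = ~-trans (D-axis i j) (~-sym (~-trans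
    (~-reflexive (cong (λ x → D x 0) (toℕ-fromℕ< _)))
    (~-trans (D-+gcd* (n % g) (n / g)) (~-reflexive (cong (λ x → D x 0) (sym (m≡m%n+[m/n]*n n g)))))))
    where
    n : ℕ
    n = i + pred b * j

  ~representative : ∀ x → x ≈ representative (class x)
  ~representative x with view x
  ... | inj₁ refl           = ~-trans (orbit-to f to-top) (D~representative 0 0)
  ... | inj₂ (i , j , refl) = D~representative i j

  orbitCount : HasOrbitCount f g
  orbitCount = record
    { to        = class
    ; from      = representative
    ; to-cong   = orbit-invariant f class class-invariant
    ; from-cong = λ { refl → ~-refl }
    ; inverse   = (λ {s} x~s → trans (orbit-invariant f class class-invariant x~s) (class-representative s))
                , (λ { {x} refl → ~-sym (~representative x) })
    }
    where
    class-representative : ∀ s → class (representative s) ≡ s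
    class-representative s = trans (class-D (toℕ s) 0) (label-representative s)

  -- Enumeration of the two kinds of orbit

  ordinary : ℕ → ℕ → X
  ordinary s k = D (s + k) k

  -- At a corner `g` would divide both `s + k + 1` and `k + 1`, hence `s`; so this cycle never meets
  -- the detour.
  ordinary-cycle : ∀ {s} → ¬ g ∣ s → Cycle f (ordinary s) (pred ℓ)
  ordinary-cycle {s} g∤s = record
    { next     = λ {k} _ → next k
    ; close    = begin
        to (ordinary s (pred ℓ))   ≡⟨ next (pred ℓ) ⟩
        ordinary s (suc (pred ℓ))  ≡⟨ cong (ordinary s) suc-pred-ℓ ⟩
        D (s + ℓ) ℓ                ≡⟨ D-period {j = 0} (m∣lcm[m,n] a b) (n∣lcm[m,n] a b) ⟩
        D s 0                      ≡⟨ cong (λ x → D x 0) (+-identityʳ s) ⟨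
        ordinary s 0               ∎
    ; distinct = λ k<l l≤ → D-distinct s 0 k<l (subst (_ <_) suc-pred-ℓ (s≤s l≤))
    }
    where
    open ≡-Reasoning
    next : ∀ k → to (ordinary s k) ≡ ordinary s (suc k)
    next k = trans (to-D λ (a∣ , b∣) → g∤s (∣m+n∣m⇒∣n {m = suc k}
        (subst (g ∣_) (cong suc (+-comm s k)) (∣-trans g∣a a∣)) (∣-trans g∣b b∣)))
      (cong (λ x → D x (suc k)) (sym (+-suc s k)))

  -- Starting at `top` moves the corner to the closing step and leaves the points `D k k` with
  -- `k < ℓ` as an unbroken run.
  exceptional : ℕ → X
  exceptional zero    = top
  exceptional (suc k) = D k k

  -- `D k k` is a corner only if both moduli divide `suc k`, which first happens at `suc k = ℓ`.
  exceptional-cycle : Cycle f exceptional ℓ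
  exceptional-cycle = record { next = next _ ; close = close ; distinct = distinct }
    where
    next : ∀ k → k < ℓ → to (exceptional k) ≡ exceptional (suc k)
    next zero    _   = to-top
    next (suc k) k<ℓ = to-D λ (a∣ , b∣) → >⇒∤ k<ℓ (lcm-least a∣ b∣)
    close : to (exceptional ℓ) ≡ top
    close = trans (cong (to ∘ exceptional) (sym suc-pred-ℓ)) (to-corner
      (subst (a ∣_) (sym suc-pred-ℓ) (m∣lcm[m,n] a b)) (subst (b ∣_) (sym suc-pred-ℓ) (n∣lcm[m,n] a b)))
    distinct : ∀ {k l} → k < l → l ≤ ℓ → exceptional k ≢ exceptional l
    distinct {zero}  {suc l} _         _   eq = D≢top (sym eq)
    distinct {suc k} {suc l} (s≤s k<l) l<ℓ eq = D-distinct 0 0 k<l l<ℓ eq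

  data OrbitShape (x : X) : Set where
    ordinaryOrbit    : ∀ s → ¬ D 0 0 ≈ x → Enumerates (applyUpTo (ordinary s) ℓ) (Orbit f x) → OrbitShape x
    exceptionalOrbit : D 0 0 ≈ x → Enumerates (applyUpTo exceptional (suc ℓ)) (Orbit f x) → OrbitShape x

  exceptional-enumerates : Enumerates (applyUpTo exceptional (suc ℓ)) (Orbit f (D 0 0))
  exceptional-enumerates = enumerates-orbit f (orbit-to f to-top) (Cycle.enumerates exceptional-cycle)

  -- Classes are residues below `g`, so `g` divides only class 0, the class of `D 0 0`.
  orbitShape : ∀ x → OrbitShape x
  orbitShape x with g ∣? toℕ (class x)
  ... | no g∤s = ordinaryOrbit s
    (λ D00~x → g∤s (subst (λ t → g ∣ toℕ t)
      (trans (sym (class-D 0 0)) (orbit-invariant f class class-invariant D00~x))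
      (subst (g ∣_) (sym toℕ-label-00) (g ∣0))))
    (enumerates-orbit f
      (~-trans (~-reflexive (cong (λ i → D i 0) (+-identityʳ s))) (~-sym (~representative x)))
      (subst (λ n → Enumerates (applyUpTo (ordinary s) n) (Orbit f (ordinary s 0)))
        suc-pred-ℓ (Cycle.enumerates (ordinary-cycle g∤s))))
    where
    s : ℕ
    s = toℕ (class x)
    toℕ-label-00 : toℕ (label 0 0) ≡ 0
    toℕ-label-00 = trans (toℕ-fromℕ< _) (trans (cong (_% g) (*-zeroʳ (pred b))) (m*n%n≡0 0 g))
  ... | yes g∣s = exceptionalOrbit D00~x (enumerates-orbit f D00~x exceptional-enumerates)
    where
    s≡0 : toℕ (class x) ≡ 0
    s≡0 = trans (sym (m<n⇒m%n≡m (toℕ<n (class x)))) (n∣m⇒m%n≡0 _ g g∣s)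
    D00~x : D 0 0 ≈ x
    D00~x = ~-sym (~-trans (~representative x) (~-reflexive (cong (λ i → D i 0) s≡0)))

  orbitSizes : ∀ {x} → D 0 0 ≡ x →
    (∀ y → ¬ x ≈ y → HasSize (Orbit f y) ℓ) × HasSize (Orbit f x) (suc ℓ)
  orbitSizes refl = ordinary-size , _ , exceptional-enumerates , length-applyUpTo exceptional (suc ℓ)
    where
    ordinary-size : ∀ x → ¬ D 0 0 ≈ x → HasSize (Orbit f x) ℓ
    ordinary-size x D00≁x with orbitShape x
    ... | ordinaryOrbit s _ e      = _ , e , length-applyUpTo (ordinary s) ℓ
    ... | exceptionalOrbit D00~x _ = contradiction D00~x D00≁x

  -- Totals of statistics that split over the coordinates

  module _ (w : X → ℕ) (u v : ℕ → ℕ) (w-D : ∀ i j → w (D i j) ≡ u (i % a) + v (j % b)) where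

    -- The quotients are `ℓ / a` and `ℓ / b`, the multiplicities of a residue in each coordinate.
    ordinaryTotal : ℕ
    ordinaryTotal = quotient (m∣lcm[m,n] a b) * sumTo u a + quotient (n∣lcm[m,n] a b) * sumTo v b

    -- A shift of the first coordinate only permutes its residues. The case `s = 0` also covers the
    -- run after `top` in the exceptional orbit.
    sum-ordinary : ∀ s → sumTo (w ∘ ordinary s) ℓ ≡ ordinaryTotal
    sum-ordinary s = begin
      sumTo (w ∘ ordinary s) ℓ
        ≡⟨ sumTo-cong ℓ (λ {k} _ → w-D (s + k) k) ⟩
      sumTo (λ k → u ((s + k) % a) + v (k % b)) ℓ
        ≡⟨ sumTo-+ (λ k → u ((s + k) % a)) (λ k → v (k % b)) ℓ ⟩
      sumTo (λ k → u ((s + k) % a)) ℓ + sumTo (λ k → v (k % b)) ℓ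
        ≡⟨ cong₂ _+_ (cong (sumTo (λ k → u ((s + k) % a))) (_∣_.equality (m∣lcm[m,n] a b)))
                     (cong (sumTo (λ k → v (k % b))) (_∣_.equality (n∣lcm[m,n] a b))) ⟩
      sumTo (λ k → u ((s + k) % a)) (quotient (m∣lcm[m,n] a b) * a)
        + sumTo (λ k → v (k % b)) (quotient (n∣lcm[m,n] a b) * b)
        ≡⟨ cong₂ _+_ (sumTo-% u a (quotient (m∣lcm[m,n] a b)) s) (sumTo-% v b (quotient (n∣lcm[m,n] a b)) 0) ⟩
      ordinaryTotal ∎
      where open ≡-Reasoning

    ordinary-total : ∀ {q} → + ordinaryTotal ℚ./ 1 ≡ q →
      ∀ x → HasSize (Orbit f x) ℓ → HasTotal w (Orbit f x) q
    ordinary-total refl x size with orbitShape x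
    ... | ordinaryOrbit s _ e = _ , e , cong (λ n → + n ℚ./ 1)
      (trans (cong sum (map-applyUpTo (ordinary s) w ℓ)) (sum-ordinary s))
    ... | exceptionalOrbit D00~x e =
      contradiction (hasSize-unique (_ , e , length-applyUpTo exceptional (suc ℓ)) size) 1+n≢n

    exceptional-total : ∀ {q} → + (w top + ordinaryTotal) ℚ./ 1 ≡ q →
      ∀ x → HasSize (Orbit f x) (suc ℓ) → HasTotal w (Orbit f x) q
    exceptional-total refl x size with orbitShape x
    ... | exceptionalOrbit D00~x e = _ , e , cong (λ n → + n ℚ./ 1)
      (trans (cong sum (map-applyUpTo exceptional w (suc ℓ))) (cong (_+_ (w top)) (sum-ordinary 0)))
    ... | ordinaryOrbit s _ e =
      contradiction (hasSize-unique size (_ , e , length-applyUpTo (ordinary s) ℓ)) 1+n≢n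

-- Totals as fractions

fraction : ∀ m d {z : ℤ} .{{_ : NonZero d}} → + (m * d) ≡ z → + m ℚ./ 1 ≡ z ℚ./ d
fraction m (suc d) refl = ℚ.fromℚᵘ-cong {mkℚᵘ (+ m) 0} {mkℚᵘ (+ (m * suc d)) d}
  (*≡* (trans (sym (ℤ.pos-* m (suc d))) (sym (ℤ.*-identityʳ _))))

fraction-suc : ∀ m {r} → + m ℚ./ 1 ≡ r → + suc m ℚ./ 1 ≡ r ℚ.+ 1ℚ
fraction-suc m refl = ℚ.toℚᵘ-injective (begin-equality
  toℚᵘ (+ suc m ℚ./ 1)              ≃⟨ ℚ.toℚᵘ-fromℚᵘ (mkℚᵘ (+ suc m) 0) ⟩
  mkℚᵘ (+ suc m) 0                  ≃⟨ *≡* (cong (ℤ._* + 1)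
    (trans (cong +_ (+-comm 1 m)) (cong (ℤ._+ + 1) (sym (ℤ.*-identityʳ (+ m)))))) ⟩
  mkℚᵘ (+ m) 0 ℚᵘ.+ mkℚᵘ (+ 1) 0    ≃⟨ ℚᵘ.+-congˡ (toℚᵘ 1ℚ) (ℚ.toℚᵘ-fromℚᵘ (mkℚᵘ (+ m) 0)) ⟨
  toℚᵘ (+ m ℚ./ 1) ℚᵘ.+ toℚᵘ 1ℚ     ≃⟨ ℚ.toℚᵘ-homo-+ (+ m ℚ./ 1) 1ℚ ⟨
  toℚᵘ (+ m ℚ./ 1 ℚ.+ 1ℚ)           ∎)
  where open ℚᵘ.≤-Reasoning

+-‿- : ∀ m n → + (m + n) ℤ.- + n ≡ + m
+-‿- m n = trans (ℤ.m-n≡m⊖n (m + n) n) (trans (ℤ.⊖-≥ (m≤n+m n m)) (cong +_ (m+n∸n≡m m n)))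

-- Cancels `a` in gcd · lcm = a · b. It identifies the multiplicities `ℓ / a` and `ℓ / b` as b / g
-- and a / g.
lcm-cofactor : ∀ a b x .{{_ : NonZero a}} → lcm a b ≡ x * a → x * gcd a b ≡ b
lcm-cofactor a b x lcm≡x*a = *-cancelʳ-≡ _ _ a (begin
  x * gcd a b * a      ≡⟨ rearrange x (gcd a b) a ⟩
  gcd a b * (x * a)    ≡⟨ cong (gcd a b *_) lcm≡x*a ⟨
  gcd a b * lcm a b    ≡⟨ gcd*lcm a b ⟩
  a * b                ≡⟨ *-comm a b ⟩
  b * a                ∎)
  where
  open ≡-Reasoning
  rearrange : ∀ x y z → x * y * z ≡ y * (x * z)
  rearrange = solve-∀

-- Ideals and antichains of the fence

suc-%-≡ : ∀ i d .{{_ : NonZero d}} → suc i % d ≡ suc (i % d) % d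
suc-%-≡ i d = trans (cong (λ x → suc x % d) (m≡m%n+[m/n]*n i d)) ([m+kn]%n≡m%n (suc (i % d)) (i / d) d)

-- The search runs downward from the top index; once some index satisfies `P`, closure supplies all
-- lower ones.
downset⇒initial-segment : {P : Pred ℕ 0ℓ} → Decidable P → ∀ n →
  (∀ {k l} → k ≤ l → l < n → P l → P k) → ∃ λ i → i ≤ n × (∀ {k} → k < n → P k ⇔ k < i)
downset⇒initial-segment P? zero    down = 0 , z≤n , λ ()
downset⇒initial-segment P? (suc n) down with P? n
... | yes p = suc n , ≤-refl , λ k<1+n → mk⇔ (λ _ → k<1+n) (λ _ → down (s≤s⁻¹ k<1+n) ≤-refl p)
... | no ¬p with downset⇒initial-segment P? n (λ k≤l l<n → down k≤l (m<n⇒m<1+n l<n))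
...   | i , i≤n , char = i , m≤n⇒m≤1+n i≤n , λ k<1+n → case (m≤n⇒m<n∨m≡n (s≤s⁻¹ k<1+n))
  where
  case : ∀ {k} → k < n ⊎ k ≡ n → _ ⇔ k < i
  case (inj₁ k<n)  = char k<n
  case (inj₂ refl) = mk⇔ (λ p → contradiction p ¬p) (λ n<i → contradiction i≤n (<⇒≱ n<i))

-- The fence F̆(p + 1, q + 1), whose peak has index p.
module TwoChains (p q : ℕ) where

  open Fence (suc p) (suc q)
  open IsDecPartialOrder ⊑-isDecPartialOrder using () renaming (_≤?_ to _⊑?_)

  n : ℕ
  n = p + suc q

  private
    p+q<n : p + q < n
    p+q<n = ≤-reflexive (sym (+-suc p q))

    p<n : p < n
    p<n = m<m+n p z<s

    -- The chain right of the peak has `q` elements, so its last `j` stay clear of every index up to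
    -- `p`. This keeps the two sides apart in the case analyses.
    too-short : ∀ {x j} → x ≤ p → j ≤ q → ¬ n ≤ x + j
    too-short x≤p j≤q = <⇒≱ (≤-<-trans (+-mono-≤ x≤p j≤q) p+q<n)

    element : ∀ {k} → k < n → ∃ λ (x : X) → toℕ x ≡ k
    element k<n = fromℕ< k<n , toℕ-fromℕ< k<n

    -- Heights right of the peak are counted from the right end, with `k = 1` at the last index.
    element-from-end : ∀ {k} → 0 < k → k ≤ n → ∃ λ (x : X) → toℕ x + k ≡ n
    element-from-end {k} 0<k k≤n =
      let x , x≡ = element (∸-monoʳ-< {n} {k} {0} 0<k k≤n) in x , trans (cong (_+ k) x≡) (m∸n+n≡m k≤n)

  -- The ideal of the i lowest elements left of the peak and the j lowest
  -- elements right of it, and its antichain of maximal elements.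
  InIdeal InAntichain : ℕ → ℕ → Pred ℕ 0ℓ
  InIdeal     i j x = x < i ⊎ n ≤ x + j
  InAntichain i j x = suc x ≡ i ⊎ x + j ≡ n

  inIdeal? : ∀ i j → Decidable (InIdeal i j)
  inIdeal? i j x = x <? i ⊎-dec n ≤? x + j

  inAntichain? : ∀ i j → Decidable (InAntichain i j)
  inAntichain? i j x = suc x ≟ i ⊎-dec x + j ≟ n

  -- Opaque, so that i and j can be inferred from ideal i j.
  opaque
    ideal antichain : ℕ → ℕ → Subset n
    ideal     i j = comprehension (inIdeal? i j ∘ toℕ)
    antichain i j = comprehension (inAntichain? i j ∘ toℕ)

    ∈-ideal⁺ : ∀ {i j} {x : X} → InIdeal i j (toℕ x) → x ∈ ideal i j
    ∈-ideal⁺ {i} {j} = ∈-comprehension⁺ (inIdeal? i j ∘ toℕ)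

    ∈-ideal⁻ : ∀ {i j} {x : X} → x ∈ ideal i j → InIdeal i j (toℕ x)
    ∈-ideal⁻ {i} {j} = ∈-comprehension⁻ (inIdeal? i j ∘ toℕ)

    ∈-antichain⁺ : ∀ {i j} {x : X} → InAntichain i j (toℕ x) → x ∈ antichain i j
    ∈-antichain⁺ {i} {j} = ∈-comprehension⁺ (inAntichain? i j ∘ toℕ)

    ∈-antichain⁻ : ∀ {i j} {x : X} → x ∈ antichain i j → InAntichain i j (toℕ x)
    ∈-antichain⁻ {i} {j} = ∈-comprehension⁻ (inAntichain? i j ∘ toℕ)

    ∣ideal∣-sum : ∀ i j → ∣ ideal i j ∣ ≡ sumTo (indicator ∘ does ∘ inIdeal? i j) n
    ∣ideal∣-sum i j = ∣tabulate∣ (does ∘ inIdeal? i j) n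

    ∣antichain∣-sum : ∀ i j → ∣ antichain i j ∣ ≡ sumTo (indicator ∘ does ∘ inAntichain? i j) n
    ∣antichain∣-sum i j = ∣tabulate∣ (does ∘ inAntichain? i j) n

  private
    generatedBy? : ∀ A → Decidable (λ x → ∃ λ y → y ∈ A × y ⊑ x)
    generatedBy? A x = any? λ y → y ∈? A ×-dec y ⊑? x

    cogeneratedBy? : ∀ A → Decidable (λ x → ∃ λ y → y ∈ A × x ⊑ y)
    cogeneratedBy? A x = any? λ y → y ∈? A ×-dec x ⊑? y

  ∈-↑⁺ : ∀ {A x y} → y ∈ A → y ⊑′ x → x ∈ ↑ A
  ∈-↑⁺ {A} y∈A y⊑x = ∈-comprehension⁺ (generatedBy? A) (_ , y∈A , ⊑′⇒⊑ y⊑x)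

  ∈-↑⁻ : ∀ {A x} → x ∈ ↑ A → ∃ λ y → y ∈ A × y ⊑′ x
  ∈-↑⁻ {A} x∈ = let y , y∈A , y⊑x = ∈-comprehension⁻ (generatedBy? A) x∈ in y , y∈A , ⊑⇒⊑′ y⊑x

  ∈-↓⁺ : ∀ {A x y} → y ∈ A → x ⊑′ y → x ∈ ↓ A
  ∈-↓⁺ {A} y∈A x⊑y = ∈-comprehension⁺ (cogeneratedBy? A) (_ , y∈A , ⊑′⇒⊑ x⊑y)

  ∈-↓⁻ : ∀ {A x} → x ∈ ↓ A → ∃ λ y → y ∈ A × x ⊑′ y
  ∈-↓⁻ {A} x∈ = let y , y∈A , x⊑y = ∈-comprehension⁻ (cogeneratedBy? A) x∈ in y , y∈A , ⊑⇒⊑′ x⊑y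

  peak : X
  peak = proj₁ (element p<n)

  toℕ-peak : toℕ peak ≡ p
  toℕ-peak = proj₂ (element p<n)

  -- Ideals omitting the peak and their antichains

  module _ {i j} (i≤p : i ≤ p) (j≤q : j ≤ q) where

    private
      pred≤p : ∀ {x} → suc x ≡ i → x ≤ p
      pred≤p 1+x≡i = ≤-trans (n≤1+n _) (subst (_≤ p) (sym 1+x≡i) i≤p)

    -- No comparison crosses sides: everything below an element off the peak lies on that element's
    -- own side.
    antichain-isAntichain : IsAntichain (antichain i j)
    antichain-isAntichain {x} {y} x∈ y∈ x⊑y with ∈-antichain⁻ x∈ | ∈-antichain⁻ y∈ | ⊑⇒⊑′ x⊑y
    ... | inj₁ 1+x≡i | inj₁ 1+y≡i | _ = toℕ-injective (suc-injective (trans 1+x≡i (sym 1+y≡i)))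
    ... | inj₂ x+j≡n | inj₂ y+j≡n | _ = toℕ-injective (+-cancelʳ-≡ j _ _ (trans x+j≡n (sym y+j≡n)))
    ... | inj₁ 1+x≡i | inj₂ y+j≡n | inj₁ (_ , y<1+p) =
      contradiction (≤-reflexive (sym y+j≡n)) (too-short (s≤s⁻¹ y<1+p) j≤q)
    ... | inj₁ 1+x≡i | inj₂ y+j≡n | inj₂ (y≤x , _) =
      contradiction (≤-reflexive (sym y+j≡n)) (too-short (≤-trans y≤x (pred≤p 1+x≡i)) j≤q)
    ... | inj₂ x+j≡n | inj₁ 1+y≡i | inj₁ (x≤y , _) =
      contradiction (≤-reflexive (sym x+j≡n)) (too-short (≤-trans x≤y (pred≤p 1+y≡i)) j≤q)
    ... | inj₂ x+j≡n | inj₁ 1+y≡i | inj₂ (_ , 1+p≤1+y) =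
      contradiction (≤-trans 1+p≤1+y (subst (_≤ p) (sym 1+y≡i) i≤p)) 1+n≰n

    ↓-antichain : ↓ (antichain i j) ≡ ideal i j
    ↓-antichain = ⊆-antisym (∈-ideal⁺ ∘ below) (above ∘ ∈-ideal⁻)
      where
      below : ∀ {x} → x ∈ ↓ (antichain i j) → InIdeal i j (toℕ x)
      below x∈ with ∈-↓⁻ x∈
      ... | y , y∈ , x⊑y with ∈-antichain⁻ y∈ | x⊑y
      ... | inj₁ 1+y≡i | inj₁ (x≤y , _)     = inj₁ (subst (_ <_) 1+y≡i (s≤s x≤y))
      ... | inj₁ 1+y≡i | inj₂ (_ , 1+p≤1+y) =
        contradiction (≤-trans 1+p≤1+y (subst (_≤ p) (sym 1+y≡i) i≤p)) 1+n≰n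
      ... | inj₂ y+j≡n | inj₁ (_ , y<1+p)   =
        contradiction (≤-reflexive (sym y+j≡n)) (too-short (s≤s⁻¹ y<1+p) j≤q)
      ... | inj₂ y+j≡n | inj₂ (y≤x , _)     = inj₂ (≤-trans (≤-reflexive (sym y+j≡n)) (+-monoˡ-≤ j y≤x))
      above : ∀ {x} → InIdeal i j (toℕ x) → x ∈ ↓ (antichain i j)
      above {x} (inj₁ x<i) =
        -- The top of the left segment has index `i ∸ 1`, where `x < i` makes `i` positive.
        let y , y≡ = element (≤-<-trans (≤-trans pred[n]≤n i≤p) p<n)
            1+y≡i = trans (cong suc y≡) (suc-pred i {{ℕ.>-nonZero (≤-<-trans z≤n x<i)}})
        in ∈-↓⁺ (∈-antichain⁺ (inj₁ 1+y≡i))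
             (inj₁ (s≤s⁻¹ (subst (toℕ x <_) (sym 1+y≡i) x<i) , ≤-trans (≤-reflexive 1+y≡i) (m≤n⇒m≤1+n i≤p)))
      above {x} (inj₂ n≤x+j) =
        let y , y+j≡n = element-from-end 0<j (≤-trans (m≤n⇒m≤1+n j≤q) (m≤n+m (suc q) p))
        in ∈-↓⁺ (∈-antichain⁺ (inj₂ y+j≡n))
             (inj₂ (+-cancelʳ-≤ j _ _ (subst (_≤ toℕ x + j) (sym y+j≡n) n≤x+j)
                   , ≰⇒> λ 1+y≤p → too-short (<⇒≤ 1+y≤p) j≤q (≤-reflexive (sym y+j≡n))))
        where
        0<j : 0 < j
        0<j = +-cancelˡ-< (toℕ x) 0 j (<-≤-trans (subst (_< n) (sym (+-identityʳ _)) (toℕ<n x)) n≤x+j)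

    ideal-isIdeal : IsIdeal (ideal i j)
    ideal-isIdeal = subst IsIdeal ↓-antichain (↓-isIdeal (antichain i j))

    peak∉ideal : peak ∉ ideal i j
    peak∉ideal peak∈ with ∈-ideal⁻ peak∈
    ... | inj₁ peak<i   = <⇒≱ (subst (_< i) toℕ-peak peak<i) i≤p
    ... | inj₂ n≤peak+j = too-short (≤-reflexive toℕ-peak) j≤q n≤peak+j

    ideal-≤ : ∀ {i′ j′} → i′ ≤ p → j′ ≤ q → ideal i j ≡ ideal i′ j′ → i ≤ i′ × j ≤ j′
    ideal-≤ {i′} {j′} i′≤p j′≤q eq = ≮⇒≥ i′≮i , ≮⇒≥ j′≮j
      where
      i′≮i : ¬ i′ < i
      -- The element of index `i′` lies in `ideal i j` but not in `ideal i′ j′`.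
      i′≮i i′<i with element (≤-<-trans i′≤p p<n)
      ... | x , x≡i′ with ∈-ideal⁻ (subst (x ∈_) eq (∈-ideal⁺ (inj₁ (subst (_< i) (sym x≡i′) i′<i))))
      ...   | inj₁ x<i′   = <⇒≢ x<i′ x≡i′
      ...   | inj₂ n≤x+j′ = too-short (≤-trans (≤-reflexive x≡i′) i′≤p) j′≤q n≤x+j′
      j′≮j : ¬ j′ < j
      -- Here the separating element is in position `suc j′` from the right end.
      j′≮j j′<j with element-from-end {suc j′} z<s (≤-trans (s≤s j′≤q) (m≤n+m (suc q) p))
      ... | x , x+1+j′≡n with ∈-ideal⁻ (subst (x ∈_) eq
                (∈-ideal⁺ (inj₂ (subst (_≤ toℕ x + j) x+1+j′≡n (+-monoʳ-≤ (toℕ x) j′<j)))))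
      ...   | inj₁ x<i′   = <⇒≢ (+-mono-<-≤ (<-≤-trans x<i′ i′≤p) (s≤s j′≤q)) x+1+j′≡n
      ...   | inj₂ n≤x+j′ = <⇒≱ (subst (toℕ x + j′ <_) x+1+j′≡n (+-monoʳ-< (toℕ x) ≤-refl)) n≤x+j′

  ideal-injective : ∀ {i j i′ j′} → i ≤ p → j ≤ q → i′ ≤ p → j′ ≤ q →
    ideal i j ≡ ideal i′ j′ → i ≡ i′ × j ≡ j′
  ideal-injective i≤p j≤q i′≤p j′≤q eq =
    let i≤i′ , j≤j′ = ideal-≤ i≤p j≤q i′≤p j′≤q eq
        i′≤i , j′≤j = ideal-≤ i′≤p j′≤q i≤p j≤q (sym eq)
    in ≤-antisym i≤i′ i′≤i , ≤-antisym j≤j′ j′≤j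

  -- Successor in ℤ/(m + 1), on the residues 0, …, m.
  data Next (m : ℕ) : ℕ → ℕ → Set where
    step : ∀ {k} → k < m → Next m k (suc k)
    wrap : Next m m 0

  module _ {i j} {x : X} (x∉ : x ∉ ideal i j) where

    i≤x : i ≤ toℕ x
    i≤x = ≮⇒≥ λ x<i → x∉ (∈-ideal⁺ (inj₁ x<i))

    x+j<n : toℕ x + j < n
    x+j<n = ≰⇒> λ n≤x+j → x∉ (∈-ideal⁺ (inj₂ n≤x+j))

  -- A generator sits one place past the old segment of its side. After a wrap that side has none:
  -- `suc y ≡ 0` is absurd, and `y + 0 ≡ n` is out of range.
  generator∉ideal : ∀ {i i′ j j′ y} → i ≤ p → j ≤ q → Next p i i′ → Next q j j′ → y < n →
    InAntichain i′ j′ y → ¬ InIdeal i j y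
  generator∉ideal _ _ (step _) _ _ (inj₁ refl) (inj₁ y<y) = <-irrefl refl y<y
  generator∉ideal _ j≤q (step y<p) _ _ (inj₁ refl) (inj₂ n≤y+j) = too-short (<⇒≤ y<p) j≤q n≤y+j
  generator∉ideal i≤p j≤q _ (step _) _ (inj₂ y+1+j≡n) (inj₁ y<i) =
    <⇒≢ (+-mono-<-≤ (<-≤-trans y<i i≤p) (s≤s j≤q)) y+1+j≡n
  generator∉ideal {j = j} {y = y} _ _ _ (step _) _ (inj₂ y+1+j≡n) (inj₂ n≤y+j) =
    <⇒≱ (subst (y + j <_) y+1+j≡n (+-monoʳ-< y ≤-refl)) n≤y+j
  generator∉ideal _ _ _ wrap y<n (inj₂ y+0≡n) _ = <⇒≢ y<n (trans (sym (+-identityʳ _)) y+0≡n)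

  left-generated : ∀ {i i′ j′ x} → Next p i i′ → i < p → i ≤ toℕ x → toℕ x ≤ p → x ∈ ↑ (antichain i′ j′)
  left-generated wrap p<p _ _ = contradiction p<p (<-irrefl refl)
  left-generated {x = x} (step i<p) _ i≤x x≤p =
    let y , y≡i = element (<-trans i<p p<n)
    in ∈-↑⁺ (∈-antichain⁺ (inj₁ (cong suc y≡i))) (inj₁ (subst (_≤ toℕ x) (sym y≡i) i≤x , s≤s x≤p))

  right-generated : ∀ {i′ j j′ x} → Next q j j′ → j < q → toℕ x + j < n → p ≤ toℕ x → x ∈ ↑ (antichain i′ j′)
  right-generated wrap q<q _ _ = contradiction q<q (<-irrefl refl)
  right-generated {j = j} {x = x} (step j<q) _ x+j<n p≤x =
    let y , y+1+j≡n = element-from-end {suc j} z<s (≤-trans (s≤s (<⇒≤ j<q)) (m≤n+m (suc q) p))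
    in ∈-↑⁺ (∈-antichain⁺ (inj₂ y+1+j≡n))
         (inj₂ (+-cancelʳ-≤ (suc j) _ _ (subst₂ _≤_ (sym (+-suc (toℕ x) j)) (sym y+1+j≡n) x+j<n) , s≤s p≤x))

  -- An element outside the ideal lies above the generator of its own side, unless that side is
  -- full. In that case it can only be the peak, which lies above the generator of the other side.
  ↑-antichain : ∀ {i i′ j j′} → i ≤ p → j ≤ q → Next p i i′ → Next q j j′ → ¬ (i ≡ p × j ≡ q) →
    ↑ (antichain i′ j′) ≡ ∁ (ideal i j)
  ↑-antichain {i} {i′} {j} {j′} i≤p j≤q nextᵢ nextⱼ ¬corner =
    ⊆-antisym (λ x∈ → x∉p⇒x∈∁p (outside x∈)) (λ x∈ → generated (x∈∁p⇒x∉p x∈))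
    where
    outside : ∀ {x} → x ∈ ↑ (antichain i′ j′) → x ∉ ideal i j
    outside x∈ x∈ideal = let y , y∈ , y⊑x = ∈-↑⁻ x∈ in
      generator∉ideal i≤p j≤q nextᵢ nextⱼ (toℕ<n y) (∈-antichain⁻ y∈)
        (∈-ideal⁻ (ideal-isIdeal i≤p j≤q x∈ideal (⊑′⇒⊑ y⊑x)))
    generated : ∀ {x} → x ∉ ideal i j → x ∈ ↑ (antichain i′ j′)
    generated {x} x∉ with m≤n⇒m<n∨m≡n i≤p | m≤n⇒m<n∨m≡n j≤q | ≤-total (toℕ x) p
    ... | inj₁ i<p  | _         | inj₁ x≤p = left-generated nextᵢ i<p (i≤x x∉) x≤p
    ... | _         | inj₁ j<q  | inj₂ p≤x = right-generated nextⱼ j<q (x+j<n x∉) p≤x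
    ... | inj₂ refl | inj₁ j<q  | inj₁ _   = right-generated nextⱼ j<q (x+j<n x∉) (i≤x x∉)
    ... | inj₁ i<p  | inj₂ refl | inj₂ _   = left-generated nextᵢ i<p (i≤x x∉)
      (s≤s⁻¹ (+-cancelʳ-< q _ _ (subst (toℕ x + q <_) (+-suc p q) (x+j<n x∉))))
    ... | inj₂ i≡p  | inj₂ j≡q  | _        = contradiction (i≡p , j≡q) ¬corner

  -- At the corner both chains are full and the peak alone remains outside.
  ↑-peak : ↑ ⁅ peak ⁆ ≡ ∁ (ideal p q)
  ↑-peak = ⊆-antisym (λ x∈ → x∉p⇒x∈∁p (outside x∈)) (λ x∈ → above (x∈∁p⇒x∉p x∈))
    where
    outside : ∀ {x} → x ∈ ↑ ⁅ peak ⁆ → x ∉ ideal p q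
    outside x∈ x∈ideal with ∈-↑⁻ x∈
    ... | y , y∈ , y⊑x with refl ← x∈⁅y⁆⇒x≡y peak y∈ =
      peak∉ideal ≤-refl ≤-refl (ideal-isIdeal ≤-refl ≤-refl x∈ideal (⊑′⇒⊑ y⊑x))
    above : ∀ {x} → x ∉ ideal p q → x ∈ ↑ ⁅ peak ⁆
    above {x} x∉ = ∈-↑⁺ (x∈⁅x⁆ peak) (inj₁
      ( subst (_≤ toℕ x) (sym toℕ-peak) (i≤x x∉)
      , +-cancelʳ-< q _ _ (subst (toℕ x + q <_) (+-suc p q) (x+j<n x∉)) ))

  -- The peak, the empty set and the classification of ideals

  ⊑-peak : ∀ x → x ⊑′ peak
  ⊑-peak x with ≤-total (toℕ x) p
  ... | inj₁ x≤p = inj₁ (subst (toℕ x ≤_) (sym toℕ-peak) x≤p , s≤s (≤-reflexive toℕ-peak))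
  ... | inj₂ p≤x = inj₂ (subst (_≤ toℕ x) (sym toℕ-peak) p≤x , s≤s (≤-reflexive (sym toℕ-peak)))

  ↓-peak : ↓ ⁅ peak ⁆ ≡ ⊤
  ↓-peak = ⊆-antisym (λ _ → ∈⊤) (λ {x} _ → ∈-↓⁺ (x∈⁅x⁆ peak) (⊑-peak x))

  peak-isAntichain : IsAntichain ⁅ peak ⁆
  peak-isAntichain x∈ y∈ _ = trans (x∈⁅y⁆⇒x≡y peak x∈) (sym (x∈⁅y⁆⇒x≡y peak y∈))

  antichain-0-0 : antichain 0 0 ≡ ⊥
  antichain-0-0 = ⊆-antisym (λ x∈ → contradiction x∈ ∉antichain) (λ x∈ → contradiction x∈ ∉⊥)
    where
    ∉antichain : ∀ {x} → x ∉ antichain 0 0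
    ∉antichain {x} x∈ with ∈-antichain⁻ x∈
    ... | inj₂ x+0≡n = <⇒≢ (toℕ<n x) (trans (sym (+-identityʳ _)) x+0≡n)

  ↓-⊥ : ↓ ⊥ ≡ ⊥
  ↓-⊥ = ⊆-antisym (λ x∈ → contradiction (proj₁ (proj₂ (∈-↓⁻ x∈))) ∉⊥) (λ x∈ → contradiction x∈ ∉⊥)

  ↑-⊥ : ↑ ⊥ ≡ ∁ ⊤
  ↑-⊥ = ⊆-antisym (λ x∈ → contradiction (proj₁ (proj₂ (∈-↑⁻ x∈))) ∉⊥) (λ x∈ → contradiction ∈⊤ (x∈∁p⇒x∉p x∈))

  -- The proof stored in an `Ideal` is irrelevant; decidability allows `viewIdeal` to recover it.
  isIdeal? : Decidable IsIdeal
  isIdeal? I = map′ (λ down {x} {y} → down x y) (λ down x y → down)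
    (all? λ x → all? λ y → x ∈? I →-dec y ⊑? x →-dec y ∈? I)

  -- The peak lies above everything, so an ideal containing it is full. Without the peak, each side
  -- is a chain that the ideal meets in an initial segment.
  ideal-view : ∀ {I} → IsIdeal I → I ≡ ⊤ ⊎ ∃₂ λ i j → i ≤ p × j ≤ q × I ≡ ideal i j
  ideal-view {I} down with peak ∈? I
  ... | yes peak∈ = inj₁ (⊆-antisym (λ _ → ∈⊤) (λ {x} _ → down peak∈ (⊑′⇒⊑ (⊑-peak x))))
  ... | no peak∉
    with downset⇒initial-segment (λ k → any? λ x → toℕ x ≟ k ×-dec x ∈? I) p left-closed
       | downset⇒initial-segment (λ k → any? λ x → toℕ x + suc k ≟ n ×-dec x ∈? I) q right-closed
    where
    left-closed : ∀ {k l} → k ≤ l → l < p →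
      (∃ λ (x : X) → toℕ x ≡ l × x ∈ I) → ∃ λ (y : X) → toℕ y ≡ k × y ∈ I
    left-closed k≤l l<p (x , refl , x∈) =
      let y , y≡k = element (≤-<-trans k≤l (toℕ<n x))
      in y , y≡k , down x∈ (⊑′⇒⊑ (inj₁ (subst (_≤ toℕ x) (sym y≡k) k≤l , m≤n⇒m≤1+n l<p)))
    -- Position `k` on the right is the index `n ∸ suc k`, so that positions increase upwards.
    right-closed : ∀ {k l} → k ≤ l → l < q →
      (∃ λ (x : X) → toℕ x + suc l ≡ n × x ∈ I) → ∃ λ (y : X) → toℕ y + suc k ≡ n × y ∈ I
    right-closed {k} {l} k≤l l<q (x , x+1+l≡n , x∈) =
      let y , y+1+k≡n = element-from-end {suc k} z<s
            (≤-trans (s≤s k≤l) (subst (suc l ≤_) x+1+l≡n (m≤n+m (suc l) (toℕ x))))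
      in y , y+1+k≡n , down x∈ (⊑′⇒⊑ (inj₂
           ( +-cancelʳ-≤ (suc k) _ _ (subst (toℕ x + suc k ≤_) (trans x+1+l≡n (sym y+1+k≡n))
               (+-monoʳ-≤ (toℕ x) (s≤s k≤l)))
           , s≤s (≮⇒≥ λ x<p → too-short (<⇒≤ x<p) l<q (≤-reflexive (sym x+1+l≡n))))))
  ...   | i , i≤p , left | j , j≤q , right =
    inj₂ (i , j , i≤p , j≤q , ⊆-antisym (∈-ideal⁺ ∘ forth) (back ∘ ∈-ideal⁻))
    where
    open Equivalence
    forth : ∀ {x} → x ∈ I → InIdeal i j (toℕ x)
    forth {x} x∈ with <-cmp (toℕ x) p
    ... | tri< x<p _ _ = inj₁ (to (left x<p) (x , refl , x∈))
    ... | tri≈ _ x≡p _ = contradiction (subst (_∈ I) (toℕ-injective (trans x≡p (sym toℕ-peak))) x∈) peak∉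
    ... | tri> _ _ p<x = inj₂ (subst (_≤ toℕ x + j) x+1+k≡n (+-monoʳ-≤ (toℕ x) (to (right k<q) (x , x+1+k≡n , x∈))))
      where
      k : ℕ
      k = n ∸ suc (toℕ x)
      x+1+k≡n : toℕ x + suc k ≡ n
      x+1+k≡n = trans (+-suc (toℕ x) k) (m+[n∸m]≡n (toℕ<n x))
      k<q : k < q
      k<q = ≰⇒> λ q≤k → <⇒≢ (+-mono-<-≤ p<x (s≤s q≤k)) (sym x+1+k≡n)
    back : ∀ {x} → InIdeal i j (toℕ x) → x ∈ I
    back {x} (inj₁ x<i) = let y , y≡x , y∈ = from (left (<-≤-trans x<i i≤p)) x<i
                          in subst (_∈ I) (toℕ-injective y≡x) y∈
    back {x} (inj₂ n≤x+j) =
      let y , y+1+k≡n , y∈ = from (right (<-≤-trans k<j j≤q)) k<j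
      in subst (_∈ I) (toℕ-injective (+-cancelʳ-≡ (suc k) _ _ (trans y+1+k≡n (sym x+1+k≡n)))) y∈
      where
      k : ℕ
      k = n ∸ suc (toℕ x)
      x+1+k≡n : toℕ x + suc k ≡ n
      x+1+k≡n = trans (+-suc (toℕ x) k) (m+[n∸m]≡n (toℕ<n x))
      k<j : k < j
      k<j = +-cancelˡ-≤ (toℕ x) _ _ (subst (_≤ toℕ x + j) (sym x+1+k≡n) n≤x+j)

  -- Cardinalities

  private
    -- The index blocks: `i` members of the ideal on the left, a gap of `m`, and `j` members at the
    -- right end.
    split-n : ∀ {i j} → i ≤ p → j ≤ q → ∃ λ m → n ≡ i + (m + j)
    split-n {i} {j} i≤p j≤q = n ∸ (i + j) , (begin
      n                         ≡⟨ m+[n∸m]≡n (≤-trans (+-mono-≤ i≤p j≤q) (<⇒≤ p+q<n)) ⟨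
      i + j + (n ∸ (i + j))     ≡⟨ +-assoc i j _ ⟩
      i + (j + (n ∸ (i + j)))   ≡⟨ cong (i ℕ.+_) (+-comm j _) ⟩
      i + (n ∸ (i + j) + j)     ∎)
      where open ≡-Reasoning

  ∣ideal∣ : ∀ {i j} → i ≤ p → j ≤ q → ∣ ideal i j ∣ ≡ i + j
  ∣ideal∣ {i} {j} i≤p j≤q with split-n i≤p j≤q
  ... | m , n≡ = begin
    ∣ ideal i j ∣
      ≡⟨ ∣ideal∣-sum i j ⟩
    sumTo h n
      ≡⟨ cong (sumTo h) n≡ ⟩
    sumTo h (i + (m + j))
      ≡⟨ trans (sumTo-split h i (m + j)) (cong (sumTo h i ℕ.+_) (sumTo-split (h ∘ (i ℕ.+_)) m j)) ⟩
    sumTo h i + (sumTo (h ∘ (i ℕ.+_)) m + sumTo (h ∘ (i ℕ.+_) ∘ (m ℕ.+_)) j)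
      ≡⟨ cong₂ _+_ (sumTo-all (inIdeal? i j) i inj₁)
           (cong₂ _+_ (sumTo-none (inIdeal? i j ∘ (i ℕ.+_)) m middle)
                      (sumTo-all (inIdeal? i j ∘ (i ℕ.+_) ∘ (m ℕ.+_)) j λ {k} _ → inj₂ (end k))) ⟩
    i + j ∎
    where
    open ≡-Reasoning
    h : ℕ → ℕ
    h = indicator ∘ does ∘ inIdeal? i j
    middle : ∀ {k} → k < m → ¬ InIdeal i j (i + k)
    middle k<m (inj₁ i+k<i) = m+n≮m i _ i+k<i
    middle {k} k<m (inj₂ n≤) = <⇒≱ (+-monoʳ-< i (+-monoˡ-< j k<m)) (subst₂ _≤_ n≡ (+-assoc i k j) n≤)
    end : ∀ k → n ≤ i + (m + k) + j
    end k = subst (_≤ i + (m + k) + j) (sym (trans n≡ (sym (+-assoc i m j))))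
      (+-monoˡ-≤ j (+-monoʳ-≤ i (m≤m+n m k)))

  -- The maximal elements flank the gap: the last index of the left block and the first of the right
  -- block, as far as these are nonempty.
  ∣antichain∣ : ∀ {i j} → i ≤ p → j ≤ q → ∣ antichain i j ∣ ≡ sgn i + sgn j
  ∣antichain∣ {i} {j} i≤p j≤q with split-n i≤p j≤q
  ... | m , n≡ = begin
    ∣ antichain i j ∣
      ≡⟨ ∣antichain∣-sum i j ⟩
    sumTo h n
      ≡⟨ cong (sumTo h) n≡ ⟩
    sumTo h (i + (m + j))
      ≡⟨ trans (sumTo-split h i (m + j)) (cong (sumTo h i ℕ.+_) (sumTo-split (h ∘ (i ℕ.+_)) m j)) ⟩
    sumTo h i + (sumTo (h ∘ (i ℕ.+_)) m + sumTo (h ∘ (i ℕ.+_) ∘ (m ℕ.+_)) j)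
      ≡⟨ cong₂ _+_ (left i refl)
           (cong₂ _+_ (sumTo-none (inAntichain? i j ∘ (i ℕ.+_)) m middle) (right j refl)) ⟩
    sgn i + sgn j ∎
    where
    open ≡-Reasoning
    h : ℕ → ℕ
    h = indicator ∘ does ∘ inAntichain? i j
    -- `i` is already bound by the enclosing clause, so the case split on it goes through an
    -- equation.
    left : ∀ i₀ → i ≡ i₀ → sumTo h i₀ ≡ sgn i₀
    left zero     _    = refl
    left (suc i₀) refl = sumTo-last-only (inAntichain? i j) i₀ (inj₁ refl) λ where
      k<i₀ (inj₁ 1+k≡i) → <⇒≢ (s<s k<i₀) 1+k≡i
      k<i₀ (inj₂ k+j≡n) → too-short (<⇒≤ (<-trans k<i₀ i≤p)) j≤q (≤-reflexive (sym k+j≡n))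
    middle : ∀ {k} → k < m → ¬ InAntichain i j (i + k)
    middle k<m (inj₁ 1+i+k≡i) = m+n≮m i _ (≤-reflexive 1+i+k≡i)
    middle {k} k<m (inj₂ i+k+j≡n) =
      <⇒≢ (+-monoʳ-< i (+-monoˡ-< j k<m)) (trans (sym (+-assoc i k j)) (trans i+k+j≡n n≡))
    right : ∀ j₀ → j ≡ j₀ → sumTo (h ∘ (i ℕ.+_) ∘ (m ℕ.+_)) j₀ ≡ sgn j₀
    right zero     _    = refl
    right (suc j₀) refl = sumTo-first-only (inAntichain? i j ∘ (i ℕ.+_) ∘ (m ℕ.+_)) j₀
      (inj₂ (trans (cong (λ k → i + k + j) (+-identityʳ m)) (trans (+-assoc i m j) (sym n≡)))) λ where
      _ (inj₁ 1+i+m+k≡i) → m+n≮m i _ (≤-reflexive 1+i+m+k≡i)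
      _ (inj₂ i+m+1+k+j≡n) → <⇒≢ (+-monoʳ-< i (+-monoˡ-< j (m<m+n m z<s)))
        (trans (trans (sym n≡) (sym i+m+1+k+j≡n)) (+-assoc i (m + _) j))

  -- Indices modulo a and b

  private
    a b : ℕ
    a = suc p
    b = suc q

    %≤ : ∀ m i → i % suc m ≤ m
    %≤ m i = s≤s⁻¹ (m%n<n i (suc m))

    last⇒∣ : ∀ m {i} → i % suc m ≡ m → suc m ∣ suc i
    last⇒∣ m {i} i≡m = m%n≡0⇒n∣m _ (suc m)
      (trans (suc-%-≡ i (suc m)) (trans (cong (λ x → suc x % suc m) i≡m) (n%n≡0 (suc m))))

    ∣⇒last : ∀ m {i} → suc m ∣ suc i → i % suc m ≡ m
    ∣⇒last m {i} m+1∣i+1 = %-pred-≡0 {i} (n∣m⇒m%n≡0 _ (suc m) m+1∣i+1)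

  next-% : ∀ m i → Next m (i % suc m) (suc i % suc m)
  next-% m i with m≤n⇒m<n∨m≡n (%≤ m i)
  ... | inj₁ i<m = subst (Next m _) (sym (trans (suc-%-≡ i (suc m)) (m<n⇒m%n≡m (s≤s i<m)))) (step i<m)
  ... | inj₂ i≡m = subst₂ (Next m) (sym i≡m) (sym (n∣m⇒m%n≡0 _ (suc m) (last⇒∣ m i≡m))) wrap

  ↓-injective : ∀ {A B} → IsAntichain A → IsAntichain B → ↓ A ≡ ↓ B → A ≡ B
  ↓-injective antiA antiB ↓A≡↓B =
    trans (sym (max-↓ (antichain⇒ᵒᵖ antiA))) (trans (cong max ↓A≡↓B) (max-↓ (antichain⇒ᵒᵖ antiB)))

  -- Avoids computing minimal elements: an antichain is recovered as the minimal elements of the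
  -- upper set it generates.
  min-∁ : ∀ {I A} → IsAntichain A → ↑ A ≡ ∁ I → min (∁ I) ≡ A
  min-∁ anti ↑A≡∁I = trans (cong min (sym ↑A≡∁I)) (min-↑ anti)

  min-∁-ideal : ∀ i j → ¬ ((a ∣ suc i) × (b ∣ suc j)) →
    min (∁ (ideal (i % a) (j % b))) ≡ antichain (suc i % a) (suc j % b)
  min-∁-ideal i j ¬corner = min-∁ (antichain-isAntichain (%≤ p (suc i)) (%≤ q (suc j)))
    (↑-antichain (%≤ p i) (%≤ q j) (next-% p i) (next-% q j)
      λ (i≡p , j≡q) → ¬corner (last⇒∣ p i≡p , last⇒∣ q j≡q))

  min-∁-corner : ∀ i j → a ∣ suc i → b ∣ suc j → min (∁ (ideal (i % a) (j % b))) ≡ ⁅ peak ⁆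
  min-∁-corner i j a∣ b∣ = trans (cong₂ (λ i j → min (∁ (ideal i j))) (∣⇒last p a∣) (∣⇒last q b∣))
    (min-∁ peak-isAntichain ↑-peak)

  ⊥-isAntichain : IsAntichain ⊥
  ⊥-isAntichain = subst IsAntichain antichain-0-0 (antichain-isAntichain z≤n z≤n)

  min-∁-⊤ : min (∁ ⊤) ≡ antichain 0 0
  min-∁-⊤ = trans (min-∁ ⊥-isAntichain ↑-⊥) (sym antichain-0-0)

  ideal-injective-% : ∀ {i i′ j j′} → ideal (i % a) (j % b) ≡ ideal (i′ % a) (j′ % b) →
    i % a ≡ i′ % a × j % b ≡ j′ % b
  ideal-injective-% {i} {i′} {j} {j′} = ideal-injective (%≤ p i) (%≤ q j) (%≤ p i′) (%≤ q j′)

  ideal≢⊤ : ∀ i j → ideal (i % a) (j % b) ≢ ⊤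
  ideal≢⊤ i j eq = peak∉ideal (%≤ p i) (%≤ q j) (subst (peak ∈_) (sym eq) ∈⊤)

  ↓-antichain-% : ∀ i j → ↓ (antichain (i % a) (j % b)) ≡ ideal (i % a) (j % b)
  ↓-antichain-% i j = ↓-antichain (%≤ p i) (%≤ q j)

  view-% : ∀ {I} → IsIdeal I → I ≡ ⊤ ⊎ ∃₂ λ i j → I ≡ ideal (i % a) (j % b)
  view-% down with ideal-view down
  ... | inj₁ I≡⊤ = inj₁ I≡⊤
  ... | inj₂ (i , j , i≤p , j≤q , I≡) =
    inj₂ (i , j , trans I≡ (sym (cong₂ ideal (m<n⇒m%n≡m (s≤s i≤p)) (m<n⇒m%n≡m (s≤s j≤q)))))

  idealAt : ℕ → ℕ → Ideal
  idealAt i j = ideal (i % a) (j % b) , [ ideal-isIdeal (%≤ p i) (%≤ q j) ]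

  fullIdeal : Ideal
  fullIdeal = ⊤ , [ (λ _ _ → ∈⊤) ]

  antichainAt : ℕ → ℕ → Antichain
  antichainAt i j = antichain (i % a) (j % b) , [ antichain-isAntichain (%≤ p i) (%≤ q j) ]

  peakAntichain : Antichain
  peakAntichain = ⁅ peak ⁆ , [ peak-isAntichain ]

  viewIdeal : ∀ I → I ≡ fullIdeal ⊎ ∃₂ λ i j → I ≡ idealAt i j
  viewIdeal (I , [ down ]) with view-% (recompute (isIdeal? I) down)
  ... | inj₁ I≡⊤           = inj₁ (value-injective I≡⊤)
  ... | inj₂ (i , j , I≡D) = inj₂ (i , j , value-injective I≡D)

  -- The classification of ideals is pulled back along `↓`, which is injective on antichains.
  viewAntichain : ∀ A → A ≡ peakAntichain ⊎ ∃₂ λ i j → A ≡ antichainAt i j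
  viewAntichain (A , [ anti ]) with view-% (↓-isIdeal A)
  ... | inj₁ ↓A≡⊤           = inj₁ (value-injective
    (recompute (≡-dec Bool._≟_ A _) (↓-injective anti peak-isAntichain (trans ↓A≡⊤ (sym ↓-peak)))))
  ... | inj₂ (i , j , ↓A≡D) = inj₂ (i , j , value-injective
    (recompute (≡-dec Bool._≟_ A _) (↓-injective anti (antichain-isAntichain (%≤ p i) (%≤ q j))
      (trans ↓A≡D (sym (↓-antichain-% i j))))))

  -- Rowmotion as a punctured translation

  ρ̂-translation : PuncturedTranslation ρ̂ a b
  ρ̂-translation = record
    { D           = idealAt
    ; top         = fullIdeal
    ; D-cong      = λ i≡ j≡ → value-injective (cong₂ ideal i≡ j≡)
    ; D-injective = λ {i} {i′} {j} {j′} D≡D′ → ideal-injective-% {i} {i′} {j} {j′} (cong value D≡D′)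
    ; D≢top       = λ {i} {j} D≡top → ideal≢⊤ i j (cong value D≡top)
    ; view        = viewIdeal
    ; to-D        = λ {i} {j} ¬corner → value-injective
        (trans (cong ↓ (min-∁-ideal i j ¬corner)) (↓-antichain-% (suc i) (suc j)))
    ; to-corner   = λ {i} {j} a∣ b∣ → value-injective (trans (cong ↓ (min-∁-corner i j a∣ b∣)) ↓-peak)
    ; to-top      = value-injective (trans (cong ↓ min-∁-⊤) (↓-antichain z≤n z≤n))
    }

  -- Passing to generated ideals by `↓-antichain-%` and `↓-peak` reduces injectivity and the
  -- rowmotion steps to facts about ideals.
  ρ-translation : PuncturedTranslation ρ a b
  ρ-translation = record
    { D           = antichainAt
    ; top         = peakAntichain
    ; D-cong      = λ i≡ j≡ → value-injective (cong₂ antichain i≡ j≡)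
    ; D-injective = λ {i} {i′} {j} {j′} D≡D′ → ideal-injective-% {i} {i′} {j} {j′}
        (trans (sym (↓-antichain-% i j)) (trans (cong (λ A → ↓ (value A)) D≡D′) (↓-antichain-% i′ j′)))
    ; D≢top       = λ {i} {j} D≡top → ideal≢⊤ i j
        (trans (sym (↓-antichain-% i j)) (trans (cong (λ A → ↓ (value A)) D≡top) ↓-peak))
    ; view        = viewAntichain
    ; to-D        = λ {i} {j} ¬corner → value-injective
        (trans (cong (λ I → min (∁ I)) (↓-antichain-% i j)) (min-∁-ideal i j ¬corner))
    ; to-corner   = λ {i} {j} a∣ b∣ → value-injective
        (trans (cong (λ I → min (∁ I)) (↓-antichain-% i j)) (min-∁-corner i j a∣ b∣))
    ; to-top      = value-injective (trans (cong (λ I → min (∁ I)) ↓-peak) min-∁-⊤)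
    }

  antichainAt-0-0 : antichainAt 0 0 ≡ ∅ᴬ
  antichainAt-0-0 = value-injective antichain-0-0

  idealAt-0-0 : idealAt 0 0 ≡ ∅ᴵ
  idealAt-0-0 = value-injective
    (trans (sym (↓-antichain z≤n z≤n)) (trans (cong ↓ antichain-0-0) ↓-⊥))

  ∣antichainAt∣ : ∀ i j → ∣ value (antichainAt i j) ∣ ≡ sgn (i % a) + sgn (j % b)
  ∣antichainAt∣ i j = ∣antichain∣ (%≤ p i) (%≤ q j)

  ∣idealAt∣ : ∀ i j → ∣ value (idealAt i j) ∣ ≡ i % a + j % b
  ∣idealAt∣ i j = ∣ideal∣ (%≤ p i) (%≤ q j)

  ∣peakAntichain∣ : ∣ value peakAntichain ∣ ≡ 1
  ∣peakAntichain∣ = ∣⁅x⁆∣≡1 peak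

  ∣fullIdeal∣ : ∣ value fullIdeal ∣ ≡ n
  ∣fullIdeal∣ = ∣⊤∣≡n n

  -- Closed formulas for the totals

  private
    g ℓ : ℕ
    g = gcd a b
    ℓ = lcm a b

    qa qb : ℕ
    qa = quotient (m∣lcm[m,n] a b)
    qb = quotient (n∣lcm[m,n] a b)

    ℓ≡qa*a : ℓ ≡ qa * a
    ℓ≡qa*a = _∣_.equality (m∣lcm[m,n] a b)

    ℓ≡qb*b : ℓ ≡ qb * b
    ℓ≡qb*b = _∣_.equality (n∣lcm[m,n] a b)

    qa*g≡b : qa * g ≡ b
    qa*g≡b = lcm-cofactor a b qa ℓ≡qa*a

    qb*g≡a : qb * g ≡ a
    qb*g≡a = trans (cong (qb *_) (gcd-comm a b)) (lcm-cofactor b a qb (trans (lcm-comm b a) ℓ≡qb*b))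

  antichainTotal idealTotal : ℕ
  antichainTotal = ordinaryTotal ρ-translation (λ A → ∣ value A ∣) sgn sgn ∣antichainAt∣
  idealTotal     = ordinaryTotal ρ̂-translation (λ I → ∣ value I ∣) (λ i → i) (λ j → j) ∣idealAt∣

  -- With multiplicities b / g and a / g the left side is b (a - 1) + a (b - 1) + b + a. Adding `b`
  -- and `a` instead of subtracting them keeps the identity in ℕ.
  antichainTotal*g : antichainTotal * g + b + a ≡ 2 * a * b
  antichainTotal*g = begin
    antichainTotal * g + b + a
      ≡⟨ cong₂ (λ x y → (qa * x + qb * y) * g + b + a) (sumTo-sgn p) (sumTo-sgn q) ⟩
    (qa * p + qb * q) * g + b + a          ≡⟨ rearrange qa qb p q g ⟩
    (qa * g) * p + (qb * g) * q + b + a    ≡⟨ cong₂ (λ x y → x * p + y * q + b + a) qa*g≡b qb*g≡a ⟩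
    b * p + a * q + b + a                  ≡⟨ combine p q ⟩
    2 * a * b                              ∎
    where
    open ≡-Reasoning
    rearrange : ∀ x y p q g → (x * p + y * q) * g + suc q + suc p ≡ (x * g) * p + (y * g) * q + suc q + suc p
    rearrange = solve-∀
    combine : ∀ p q → suc q * p + suc p * q + suc q + suc p ≡ 2 * suc p * suc q
    combine = solve-∀

  -- Twice the sum of the residues modulo `a` is (a - 1) a, and ℓ / a copies of it make ℓ (a - 1);
  -- likewise for `b`.
  idealTotal*2 : idealTotal * 2 ≡ ℓ * (p + q)
  idealTotal*2 = begin
    (qa * sumTo (λ i → i) a + qb * sumTo (λ j → j) b) * 2   ≡⟨ rearrange qa _ qb _ ⟩
    qa * (2 * sumTo (λ i → i) a) + qb * (2 * sumTo (λ j → j) b)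
      ≡⟨ cong₂ (λ x y → qa * x + qb * y) (sumTo-id p) (sumTo-id q) ⟩
    qa * (p * a) + qb * (q * b)        ≡⟨ regroup qa p qb q ⟩
    qa * a * p + qb * b * q
      ≡⟨ cong₂ (λ x y → x * p + y * q) ℓ≡qa*a ℓ≡qb*b ⟨
    ℓ * p + ℓ * q                      ≡⟨ *-distribˡ-+ ℓ p q ⟨
    ℓ * (p + q)                        ∎
    where
    open ≡-Reasoning
    rearrange : ∀ x s y t → (x * s + y * t) * 2 ≡ x * (2 * s) + y * (2 * t)
    rearrange = solve-∀
    regroup : ∀ x p y q → x * (p * suc p) + y * (q * suc q) ≡ x * suc p * p + y * suc q * q
    regroup = solve-∀

  antichainTotal≡ : (2≤a : 2 ≤ a) → + antichainTotal ℚ./ 1 ≡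
    ℚ._/_ (+ (2 * a * b) ℤ.- + a ℤ.- + b) g {{gcd-nonZero b 2≤a}}
  antichainTotal≡ 2≤a = fraction antichainTotal g {{gcd-nonZero b 2≤a}} (sym (begin
    + (2 * a * b) ℤ.- + a ℤ.- + b                     ≡⟨ cong (λ x → + x ℤ.- + a ℤ.- + b) antichainTotal*g ⟨
    + (antichainTotal * g + b + a) ℤ.- + a ℤ.- + b    ≡⟨ cong (ℤ._- + b) (+-‿- (antichainTotal * g + b) a) ⟩
    + (antichainTotal * g + b) ℤ.- + b                ≡⟨ +-‿- (antichainTotal * g) b ⟩
    + (antichainTotal * g)                            ∎))
    where open ≡-Reasoning

  private
    r : ℤ
    r = + (a + b) ℤ.- + 2

  r≡p+q : r ≡ + (p + q)
  r≡p+q = trans (cong (λ x → + x ℤ.- + 2) (rearrange p q)) (+-‿- (p + q) 2)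
    where
    rearrange : ∀ p q → suc p + suc q ≡ p + q + 2
    rearrange = solve-∀

  idealTotal≡ : + idealTotal ℚ./ 1 ≡ (+ ℓ ℤ.* r) ℚ./ 2
  idealTotal≡ = fraction idealTotal 2 (begin
    + (idealTotal * 2)    ≡⟨ cong +_ idealTotal*2 ⟩
    + (ℓ * (p + q))       ≡⟨ ℤ.pos-* ℓ (p + q) ⟩
    + ℓ ℤ.* + (p + q)     ≡⟨ cong (+ ℓ ℤ.*_) r≡p+q ⟨
    + ℓ ℤ.* r             ∎)
    where open ≡-Reasoning

  -- The whole poset has `p + q + 1` elements: after doubling, `p + q` raises the factor `ℓ` to
  -- `ℓ + 2`, and the remaining 1 is the final summand.
  exceptionalIdealTotal≡ : + (∣ value fullIdeal ∣ + idealTotal) ℚ./ 1 ≡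
    (+ (ℓ + 2) ℤ.* r) ℚ./ 2 ℚ.+ 1ℚ
  exceptionalIdealTotal≡ = trans
    (cong (λ x → + x ℚ./ 1) (cong (λ x → x + idealTotal) (trans ∣fullIdeal∣ (+-suc p q))))
    (fraction-suc (p + q + idealTotal) (fraction (p + q + idealTotal) 2 (begin
      + ((p + q + idealTotal) * 2)          ≡⟨ cong +_ (*-distribʳ-+ 2 (p + q) idealTotal) ⟩
      + ((p + q) * 2 + idealTotal * 2)      ≡⟨ cong (λ x → + ((p + q) * 2 + x)) idealTotal*2 ⟩
      + ((p + q) * 2 + ℓ * (p + q))         ≡⟨ cong +_ (rearrange (p + q) ℓ) ⟩
      + ((ℓ + 2) * (p + q))                 ≡⟨ ℤ.pos-* (ℓ + 2) (p + q) ⟩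
      + (ℓ + 2) ℤ.* + (p + q)               ≡⟨ cong (+ (ℓ + 2) ℤ.*_) r≡p+q ⟨
      + (ℓ + 2) ℤ.* r                       ∎)))
    where
    open ≡-Reasoning
    rearrange : ∀ s l → s * 2 + l * s ≡ (l + 2) * s
    rearrange = solve-∀

theorem4p3 : (a b : ℕ) (2≤a : 2 ≤ a) (2≤b : 2 ≤ b) →
    let open Fence a b
        ℓ = lcm a b
        m = ℚ._/_ (+ (2 ℕ.* a ℕ.* b) ℤ.- + a ℤ.- + b) (gcd a b) {{gcd-nonZero b 2≤a}}
        r = + (a ℕ.+ b) ℤ.- + 2
    in
      ((∀ A → ¬ Orbit ρ ∅ᴬ A → HasSize (Orbit ρ A) ℓ) × HasSize (Orbit ρ ∅ᴬ) (suc ℓ))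
    × ((∀ I → ¬ Orbit ρ̂ ∅ᴵ I → HasSize (Orbit ρ̂ I) ℓ) × HasSize (Orbit ρ̂ ∅ᴵ) (suc ℓ))
    × HasOrbitCount ρ (gcd a b)
    × HasOrbitCount ρ̂ (gcd a b)
    × (∀ A → HasSize (Orbit ρ A) ℓ → HasTotal (λ B → ∣ value B ∣) (Orbit ρ A) m)
    × (∀ A → HasSize (Orbit ρ A) (suc ℓ) → HasTotal (λ B → ∣ value B ∣) (Orbit ρ A) (m ℚ.+ 1ℚ))
    × (∀ I → HasSize (Orbit ρ̂ I) ℓ →
         HasTotal (λ J → ∣ value J ∣) (Orbit ρ̂ I) ((+ ℓ ℤ.* r) ℚ./ 2))
    × (∀ I → HasSize (Orbit ρ̂ I) (suc ℓ) →
         HasTotal (λ J → ∣ value J ∣) (Orbit ρ̂ I) ((+ (ℓ ℕ.+ 2) ℤ.* r) ℚ./ 2 ℚ.+ 1ℚ))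
-- `2 ≤ a` and `2 ≤ b` exclude zero; `p` and `q` count the elements on either side of the peak.
theorem4p3 (suc p) (suc q) 2≤a 2≤b =
    orbitSizes ρ-translation antichainAt-0-0
  , orbitSizes ρ̂-translation idealAt-0-0
  , orbitCount ρ-translation
  , orbitCount ρ̂-translation
  , ordinary-total ρ-translation _ sgn sgn ∣antichainAt∣ (antichainTotal≡ 2≤a)
  , exceptional-total ρ-translation _ sgn sgn ∣antichainAt∣
      (trans (cong (λ k → + (k + antichainTotal) ℚ./ 1) ∣peakAntichain∣)
        (fraction-suc antichainTotal (antichainTotal≡ 2≤a)))
  , ordinary-total ρ̂-translation _ (λ i → i) (λ j → j) ∣idealAt∣ idealTotal≡
  , exceptional-total ρ̂-translation _ (λ i → i) (λ j → j) ∣idealAt∣ exceptionalIdealTotal≡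
  where open TwoChains p q
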